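{- Let $m\ge 3$ and $n\ge 3$. The Kirchhoff index of the complete flower graph $F_n(K_m)$ is $$Kf(F_n(K_m))=\frac{n\left(5+12n+n^2+m^2(-1+6n+n^2)-m(1+18n+2n^2)\right)}{6m}.$$
   Context: For a connected graph $H$ with vertex set $\{1,\dots,N\}$ and Laplacian matrix $L$, the resistance distance between vertices $i,j$ is $r_H(i,j)=(e_i-e_j)^T L^\dagger (e_i-e_j)$, where $e_i$ is the $i$th standard unit vector and $L^\dagger$ is the Moore–Penrose pseudoinverse of $L$. The Kirchhoff index is $Kf(H)=\frac12\sum_{i,j\in V(H)} r_H(i,j)$ (sum over ordered pairs). Complete flower graph: for $m\ge3$, $n\ge 3$, fix two distinct vertices $x,y$ of the complete graph $K_m$ (the choice is irrelevant up to isomorphism). $F_n(K_m)$ is obtained from $n$ vertex-disjoint copies $G_1,\dots,G_n$ of $K_m$, with $x_i,y_i$ the copies of $x,y$ in $G_i$, by identifying $y_i$ with $x_{i+1}$ for $1\le i<n$ and $y_n$ with $x_1$. -}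

module Defs where

open import Data.Bool.Base using (if_then_else_)
open import Data.Fin.Base using (Fin; toℕ; punchOut; combine)
open import Data.Fin.Properties
  using (_≟_; any?; toℕ<n; toℕ-fromℕ<; punchOut-injective; combine-injective)
open import Data.Nat.Base as ℕ using (ℕ; suc; pred; NonZero; s≤s; z≤n)
open import Data.Nat.DivMod as ℕ using (_mod_; m%n<n; m<n⇒m%n≡m; n%n≡0)
open import Data.Nat.Properties as ℕ using (m≤n⇒m<n∨m≡n)
open import Data.Product.Base using (_×_; _,_; proj₁; proj₂; ∃-syntax)
open import Data.Rational.Base using (ℚ; 0ℚ; 1ℚ; ½; _+_; _*_; _-_)
open import Data.Rational.Properties using (+-0-commutativeMonoid)
open import Data.Sum.Base using (inj₁; inj₂)
open import Level using (0ℓ)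
open import Relation.Binary.Core using (Rel)
open import Relation.Binary.Definitions using (Decidable; Irreflexive; Symmetric)
open import Relation.Binary.PropositionalEquality
  using (_≡_; _≢_; refl; sym; trans; cong)
open import Relation.Nullary.Decidable using (does; yes; no; ¬?; _×-dec_)
open import Relation.Nullary.Negation using (contradiction)

open import Algebra.Properties.CommutativeMonoid.Sum +-0-commutativeMonoid public
  using (sum; sum-syntax)

------------------------------------------------------------------------
-- Rational matrices

Vector : ℕ → Set
Vector n = Fin n → ℚ

Matrix : ℕ → Set
Matrix n = Fin n → Fin n → ℚ

infixl 7 _⊗_
infix  8 _ᵀ
infix  4 _≈_

_⊗_ : ∀ {n} → Matrix n → Matrix n → Matrix n
_⊗_ {n} A B i j = ∑[ k < n ] (A i k * B k j)

_ᵀ : ∀ {n} → Matrix n → Matrix n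
(A ᵀ) i j = A j i

_≈_ : ∀ {n} → Rel (Matrix n) 0ℓ
A ≈ B = ∀ i j → A i j ≡ B i j

-- The four Penrose equations.  They have at most one solution, and a
-- rational solution is also the pseudoinverse of A as a real matrix.
record IsMoorePenroseInverse {n} (A X : Matrix n) : Set where
  field
    AXA≈A  : A ⊗ X ⊗ A ≈ A
    XAX≈X  : X ⊗ A ⊗ X ≈ X
    AX-sym : (A ⊗ X) ᵀ ≈ A ⊗ X
    XA-sym : (X ⊗ A) ᵀ ≈ X ⊗ A

unit : ∀ {n} → Fin n → Vector n
unit i k = if does (i ≟ k) then 1ℚ else 0ℚ

------------------------------------------------------------------------
-- Graphs and the Kirchhoff index

record SimpleGraph (N : ℕ) : Set₁ where
  field
    Adj    : Rel (Fin N) 0ℓ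
    adj?   : Decidable Adj
    symm   : Symmetric Adj
    irrefl : Irreflexive _≡_ Adj

module _ {N : ℕ} (G : SimpleGraph N) where
  open SimpleGraph G

  adjacency : Matrix N
  adjacency i j = if does (adj? i j) then 1ℚ else 0ℚ

  degree : Fin N → ℚ
  degree i = ∑[ k < N ] adjacency i k

  laplacian : Matrix N
  laplacian i j = (if does (i ≟ j) then degree i else 0ℚ) - adjacency i j

-- (eᵢ - eⱼ)ᵀ P (eᵢ - eⱼ), to be used with P the pseudoinverse of a
-- Laplacian.
resistance : ∀ {N} → Matrix N → Fin N → Fin N → ℚ
resistance {N} P i j = ∑[ k < N ] ∑[ l < N ] (d k * P k l * d l)
  where
  d : Vector N
  d k = unit i k - unit j k

halfTotalResistance : ∀ {N} → Matrix N → ℚ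
halfTotalResistance {N} P = ½ * (∑[ i < N ] ∑[ j < N ] resistance P i j)

-- The pseudoinverse is specified rather than computed, so Kf(G) = q is
-- a relation.  The first component excludes vacuous truth of the second.
_HasKirchhoffIndex_ : ∀ {N} → SimpleGraph N → ℚ → Set
G HasKirchhoffIndex q =
  (∃[ L⁺ ] IsMoorePenroseInverse (laplacian G) L⁺) ×
  (∀ L⁺ → IsMoorePenroseInverse (laplacian G) L⁺ → halfTotalResistance L⁺ ≡ q)

------------------------------------------------------------------------
-- Complete flower graphs

-- Cyclic successor: i ↦ i + 1 mod n.
next : ∀ {n} → Fin n → Fin n
next {suc n} i = suc (toℕ i) mod suc n

next≢ : ∀ {n} → 1 ℕ.< n → (i : Fin n) → next i ≢ i
next≢ {suc n} (s≤s 0<n) i eq with m≤n⇒m<n∨m≡n (toℕ<n i)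
... | inj₁ 1+i<1+n = ℕ.1+n≢n
  (trans (sym (m<n⇒m%n≡m 1+i<1+n))
         (trans (sym (toℕ-fromℕ< (m%n<n (suc (toℕ i)) (suc n)))) (cong toℕ eq)))
... | inj₂ 1+i≡1+n = ℕ.<⇒≢ 0<n
  (trans (sym i≡0) (cong pred 1+i≡1+n))
  where
  i≡0 : toℕ i ≡ 0
  i≡0 = trans (cong toℕ (sym eq))
       (trans (toℕ-fromℕ< (m%n<n (suc (toℕ i)) (suc n)))
       (trans (cong (ℕ._% suc n) 1+i≡1+n) (n%n≡0 (suc n))))

-- Removing y leaves a set of pred m elements.
delete : ∀ {m} (y : Fin m) {a : Fin m} → y ≢ a → Fin (pred m)
delete {suc m} y = punchOut

delete-injective : ∀ {m} (y : Fin m) {a b} (p : y ≢ a) (q : y ≢ b) →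
                   delete y p ≡ delete y q → a ≡ b
delete-injective {suc m} y = punchOut-injective

-- The quotient map from n disjoint copies of Fin m to the vertices of the
-- flower, identifying y in copy i with x in copy (next i).  Every class
-- has exactly one representative (i , a) with a ≢ y, whence n * pred m
-- vertices.
glue : ∀ {n m} {x y : Fin m} → x ≢ y → Fin n → Fin m → Fin (n ℕ.* pred m)
glue {x = x} {y} x≢y i a with y ≟ a
... | yes _   = combine (next i) (delete y {x} (λ y≡x → x≢y (sym y≡x)))
... | no  y≢a = combine i (delete y y≢a)

glue-injective : ∀ {n m} → 1 ℕ.< n → {x y : Fin m} (x≢y : x ≢ y) (i : Fin n) →
                 ∀ {a b} → glue x≢y i a ≡ glue x≢y i b → a ≡ b
glue-injective 1<n {y = y} x≢y i {a} {b} eq with y ≟ a | y ≟ b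
... | yes refl | yes refl = refl
... | yes _    | no _     =
  contradiction (proj₁ (combine-injective (next i) _ i _ eq)) (next≢ 1<n i)
... | no _     | yes _    =
  contradiction (sym (proj₁ (combine-injective i _ (next i) _ eq))) (next≢ 1<n i)
... | no y≢a   | no y≢b   =
  delete-injective y y≢a y≢b (proj₂ (combine-injective i _ i _ eq))

-- The image of n disjoint copies of K_m under glue.  No parallel edges
-- are merged here when n ≥ 3.
completeFlower : ∀ {n m} → 3 ℕ.≤ n → {x y : Fin m} → x ≢ y →
                 SimpleGraph (n ℕ.* pred m)
completeFlower {n} {m} 3≤n x≢y = record
  { Adj    = λ u v → ∃[ i ] ∃[ a ] ∃[ b ] (a ≢ b × glue x≢y i a ≡ u × glue x≢y i b ≡ v)
  ; adj?   = λ u v → any? λ i → any? λ a → any? λ b →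
               ¬? (a ≟ b) ×-dec (glue x≢y i a ≟ u) ×-dec (glue x≢y i b ≟ v)
  ; symm   = λ (i , a , b , a≢b , p , q) → i , b , a , (λ b≡a → a≢b (sym b≡a)) , q , p
  ; irrefl = λ { refl (i , a , b , a≢b , p , q) →
               a≢b (glue-injective (ℕ.≤-trans (s≤s (s≤s z≤n)) 3≤n) x≢y i (trans p (sym q))) }
  }

6m≢0 : ∀ {m} → 3 ℕ.≤ m → NonZero (6 ℕ.* m)
6m≢0 (s≤s _) = _

{-# OPTIONS --safe #-}

-- Let r = 1/m.  A star-mesh reduction of each petal (with x, y as terminals)
-- turns the flower into an n-cycle of resistances 2r, whose grounded Green
-- function is elementary.  Extending it to the remaining vertices yields an
-- explicit symmetric matrix G with L G = I - e 1ᵀ, where e is the indicator of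
-- one hub.  Centering G on both sides gives the pseudoinverse of L and leaves
-- all resistances unchanged, so Kf = N tr G - Σ G for N the number of vertices,
-- and both terms are sums of quadratic polynomials along the cycle.
module Submission where

open import Defs
open import Data.Nat.Base as ℕ using (ℕ; zero; suc; z≤n; s≤s; _⊓_)
open import Data.Fin.Base using (Fin; zero; suc; toℕ; combine; remQuot; punchIn; punchOut; _↑ˡ_; _↑ʳ_)
open import Data.Rational.Base using (ℚ; 0ℚ; 1ℚ; ½; toℚᵘ; _/_)
open import Algebra.Properties.CommutativeMonoid.Sum as Sum using ()
open import Algebra.Properties.Semiring.Sum as SemiringSum using ()
open import Algebra.Bundles using (module CommutativeRing)
open import Data.Bool.Base using (if_then_else_)
open import Data.Fin.Properties
  using (_≟_; any?; toℕ<n; toℕ≤n; toℕ-fromℕ<; toℕ-injective; combine-injectiveˡ; remQuot-combine; combine-remQuot;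
         punchOut-cong; punchOut-punchIn; punchIn-punchOut; punchInᵢ≢i)
open import Data.Integer.Base as ℤ using (ℤ)
import Data.Integer.Properties as ℤ
open import Data.Nat.DivMod using (_mod_; m%n<n; m<n⇒m%n≡m; n%n≡0)
import Data.Nat.Properties as ℕ
open import Data.Product.Base using (_,_; _×_; proj₁; proj₂)
open import Data.Rational.Properties as ℚ using (+-0-commutativeMonoid; +-*-commutativeRing)
open import Data.Rational.Solver using (module +-*-Solver)
open import Data.Rational.Unnormalised.Base as ℚᵘ using (mkℚᵘ; *≡*)
import Data.Rational.Unnormalised.Properties as ℚᵘ
open import Data.Sum.Base using (inj₁; inj₂)
open import Relation.Binary.PropositionalEquality
  using (_≡_; _≢_; refl; sym; trans; cong; cong₂; subst; ≢-sym; module ≡-Reasoning)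
open import Relation.Nullary.Decidable using (Dec; does; yes; no; ¬?; _×-dec_)
open import Relation.Nullary.Negation using (contradiction)

-- A hub lies in two petals but has a single vertex code. Functions on vertices are therefore
-- treated as functions of (petal, place) that agree at the two names of each hub (`Glued`), and the
-- Laplacian is written as a sum of petal Laplacians mI - J. Every verification then happens inside
-- one K_m or along the cycle, with no case split between hubs and inner vertices. The decomposition
-- requires that no edge lie in two petals, which is where n ≥ 3 enters.
--
-- Origin of the constants in the potential `g`: two vertices of K_m are at resistance 2/m, whence
-- `r + r`. In a petal without source, symmetry puts every inner vertex midway between x and y,
-- whence the interpolation weight ½. In the petal of the source, hold x and y at potential 0: the m
-- - 2 inner vertices then carry the matrix mI - J of that size, whose inverse is (I + J/2)/m, and
-- this gives the coefficients `r` and `½ * r`.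
--
-- The statement quantifies over all solutions of the Penrose equations, so uniqueness of the
-- pseudoinverse is proved alongside its construction.

module FlowerResistance where
  open import Data.Rational.Base using (_+_; _*_; _-_; -_)
  open ≡-Reasoning
  open +-*-Solver using (solve; con; _:+_; _:*_; _:-_; _:=_)
  open Sum +-0-commutativeMonoid using (sum-cong-≗; ∑-distrib-+; ∑-comm; sum-remove)
  open SemiringSum (CommutativeRing.semiring +-*-commutativeRing) using (*-distribˡ-sum)

  -- Embedding ℤ and ℕ in ℚ

  fromℤ : ℤ → ℚ
  fromℤ z = z / 1

  fromℤ-≃ : ∀ z → toℚᵘ (fromℤ z) ℚᵘ.≃ mkℚᵘ z 0
  fromℤ-≃ z = ℚ.toℚᵘ-fromℚᵘ (mkℚᵘ z 0)

  fromℤ-+ : ∀ a b → fromℤ (a ℤ.+ b) ≡ fromℤ a + fromℤ b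
  fromℤ-+ a b = ℚ.toℚᵘ-injective (ℚᵘ.≃-trans (fromℤ-≃ (a ℤ.+ b))
    (ℚᵘ.≃-trans (*≡* (cong (ℤ._* ℤ.+ 1) (sym (cong₂ ℤ._+_ (ℤ.*-identityʳ a) (ℤ.*-identityʳ b)))))
    (ℚᵘ.≃-sym (ℚᵘ.≃-trans (ℚ.toℚᵘ-homo-+ (fromℤ a) (fromℤ b))
      (ℚᵘ.+-cong (fromℤ-≃ a) (fromℤ-≃ b))))))

  fromℤ-* : ∀ a b → fromℤ (a ℤ.* b) ≡ fromℤ a * fromℤ b
  fromℤ-* a b = ℚ.toℚᵘ-injective (ℚᵘ.≃-trans (fromℤ-≃ (a ℤ.* b))
    (ℚᵘ.≃-sym (ℚᵘ.≃-trans (ℚ.toℚᵘ-homo-* (fromℤ a) (fromℤ b))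
      (ℚᵘ.*-cong (fromℤ-≃ a) (fromℤ-≃ b)))))

  fromℤ-neg : ∀ a → fromℤ (ℤ.- a) ≡ - fromℤ a
  fromℤ-neg a = ℚ.toℚᵘ-injective (ℚᵘ.≃-trans (fromℤ-≃ (ℤ.- a))
    (ℚᵘ.≃-sym (ℚᵘ.≃-trans (ℚ.toℚᵘ-homo‿- (fromℤ a)) (ℚᵘ.-‿cong (fromℤ-≃ a)))))

  /-* : ∀ z d .{{_ : ℕ.NonZero d}} → (z / d) * fromℤ (ℤ.+ d) ≡ fromℤ z
  /-* z d@(suc d-1) = ℚ.toℚᵘ-injective (ℚᵘ.≃-trans (ℚ.toℚᵘ-homo-* (z / d) (fromℤ (ℤ.+ d)))
    (ℚᵘ.≃-trans (ℚᵘ.*-cong (ℚ.toℚᵘ-fromℚᵘ (mkℚᵘ z d-1)) (fromℤ-≃ (ℤ.+ d)))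
    (ℚᵘ.≃-trans (*≡* (trans (ℤ.*-identityʳ (z ℤ.* ℤ.+ d)) (cong (λ e → z ℤ.* ℤ.+ e) (sym (ℕ.*-identityʳ d)))))
     (ℚᵘ.≃-sym (fromℤ-≃ z)))))

  ι : ℕ → ℚ
  ι n = fromℤ (ℤ.+ n)

  ι-suc : ∀ n → ι (suc n) ≡ 1ℚ + ι n
  ι-suc n = fromℤ-+ (ℤ.+ 1) (ℤ.+ n)

  -- Finite sums

  ∑-cong : ∀ {n} {f g : Vector n} → (∀ i → f i ≡ g i) → ∑[ i < n ] f i ≡ ∑[ i < n ] g i
  ∑-cong = sum-cong-≗

  ∑-+ : ∀ {n} (f g : Vector n) → ∑[ i < n ] (f i + g i) ≡ ∑[ i < n ] f i + ∑[ i < n ] g i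
  ∑-+ = ∑-distrib-+

  ∑-*ˡ : ∀ {n} c (f : Vector n) → ∑[ i < n ] (c * f i) ≡ c * ∑[ i < n ] f i
  ∑-*ˡ c f = sym (*-distribˡ-sum c f)

  ∑-*ʳ : ∀ {n} (f : Vector n) c → ∑[ i < n ] (f i * c) ≡ (∑[ i < n ] f i) * c
  ∑-*ʳ f c = trans (∑-cong λ i → ℚ.*-comm (f i) c) (trans (∑-*ˡ c f) (ℚ.*-comm c _))

  ∑-- : ∀ {n} (f g : Vector n) → ∑[ i < n ] (f i - g i) ≡ ∑[ i < n ] f i - ∑[ i < n ] g i
  ∑-- {n} f g = begin
    ∑[ i < n ] (f i - g i)
      ≡⟨ ∑-cong (λ i → solve 2 (λ a b → a :- b := a :+ con (- 1ℚ) :* b) refl (f i) (g i)) ⟩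
    ∑[ i < n ] (f i + - 1ℚ * g i)
      ≡⟨ ∑-+ f (λ i → - 1ℚ * g i) ⟩
    ∑[ i < n ] f i + ∑[ i < n ] (- 1ℚ * g i)
      ≡⟨ cong ((∑[ i < n ] f i) +_) (∑-*ˡ (- 1ℚ) g) ⟩
    ∑[ i < n ] f i + - 1ℚ * ∑[ i < n ] g i
      ≡⟨ solve 2 (λ a b → a :+ con (- 1ℚ) :* b := a :- b) refl (∑[ i < n ] f i) (∑[ i < n ] g i) ⟩
    ∑[ i < n ] f i - ∑[ i < n ] g i ∎

  ∑-const : ∀ n c → ∑[ i < n ] c ≡ ι n * c
  ∑-const zero    c = sym (ℚ.*-zeroˡ c)
  ∑-const (suc n) c = begin
    c + ∑[ i < n ] c ≡⟨ cong (c +_) (∑-const n c) ⟩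
    c + ι n * c      ≡⟨ solve 2 (λ c x → c :+ x :* c := (con 1ℚ :+ x) :* c) refl c (ι n) ⟩
    (1ℚ + ι n) * c   ≡⟨ cong (_* c) (ι-suc n) ⟨
    ι (suc n) * c    ∎

  ∑-0 : ∀ n → ∑[ i < n ] 0ℚ ≡ 0ℚ
  ∑-0 n = trans (∑-const n 0ℚ) (ℚ.*-zeroʳ (ι n))

  unit-sym : ∀ {n} (i j : Fin n) → unit i j ≡ unit j i
  unit-sym zero    zero    = refl
  unit-sym zero    (suc j) = refl
  unit-sym (suc i) zero    = refl
  unit-sym (suc i) (suc j) = unit-sym i j

  unit-refl : ∀ {n} (i : Fin n) → unit i i ≡ 1ℚ
  unit-refl zero    = refl
  unit-refl (suc i) = unit-refl i

  unit-≢ : ∀ {n} {i j : Fin n} → i ≢ j → unit i j ≡ 0ℚ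
  unit-≢ {i = i} {j} i≢j with i ≟ j
  ... | yes i≡j = contradiction i≡j i≢j
  ... | no _    = refl

  unit-subst : ∀ {n} (f : Vector n) (i j : Fin n) → unit i j * f i ≡ unit i j * f j
  unit-subst f i j with i ≟ j
  ... | yes refl = refl
  ... | no _     = trans (ℚ.*-zeroˡ (f i)) (sym (ℚ.*-zeroˡ (f j)))

  ∑-unit : ∀ {n} (i : Fin n) (f : Vector n) → ∑[ k < n ] (unit i k * f k) ≡ f i
  ∑-unit {suc n} zero f = begin
    1ℚ * f zero + ∑[ k < n ] (0ℚ * f (suc k))
      ≡⟨ cong₂ _+_ (ℚ.*-identityˡ (f zero)) (trans (∑-cong {n} (λ k → ℚ.*-zeroˡ (f (suc k)))) (∑-0 n)) ⟩
    f zero + 0ℚ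
      ≡⟨ ℚ.+-identityʳ (f zero) ⟩
    f zero ∎
  ∑-unit {suc n} (suc i) f = begin
    0ℚ * f zero + ∑[ k < n ] (unit i k * f (suc k))
      ≡⟨ cong₂ _+_ (ℚ.*-zeroˡ (f zero)) (∑-unit i (λ k → f (suc k))) ⟩
    0ℚ + f (suc i)
      ≡⟨ ℚ.+-identityˡ (f (suc i)) ⟩
    f (suc i) ∎

  ∑-unit-1 : ∀ {n} (i : Fin n) → ∑[ k < n ] unit i k ≡ 1ℚ
  ∑-unit-1 i = trans (∑-cong λ k → sym (ℚ.*-identityʳ (unit i k))) (∑-unit i (λ _ → 1ℚ))

  -- Matrices and their pseudoinverses

  module _ {n : ℕ} where

    ⊗-cong : {A A′ B B′ : Matrix n} → A ≈ A′ → B ≈ B′ → A ⊗ B ≈ A′ ⊗ B′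
    ⊗-cong p q i j = ∑-cong λ k → cong₂ _*_ (p i k) (q k j)

    ⊗-assoc : (A B C : Matrix n) → A ⊗ B ⊗ C ≈ A ⊗ (B ⊗ C)
    ⊗-assoc A B C i j = begin
      ∑[ k < n ] ((∑[ l < n ] (A i l * B l k)) * C k j)
        ≡⟨ ∑-cong {n} (λ k → sym (∑-*ʳ (λ l → A i l * B l k) (C k j))) ⟩
      ∑[ k < n ] ∑[ l < n ] (A i l * B l k * C k j)
        ≡⟨ ∑-comm (λ k l → A i l * B l k * C k j) ⟩
      ∑[ l < n ] ∑[ k < n ] (A i l * B l k * C k j)
        ≡⟨ ∑-cong {n} (λ l → trans (∑-cong {n} λ k → ℚ.*-assoc (A i l) (B l k) (C k j))
                                   (∑-*ˡ (A i l) (λ k → B l k * C k j))) ⟩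
      ∑[ l < n ] (A i l * ∑[ k < n ] (B l k * C k j)) ∎

    ⊗-ᵀ : {A B : Matrix n} → A ᵀ ≈ A → B ᵀ ≈ B → (A ⊗ B) ᵀ ≈ B ⊗ A
    ⊗-ᵀ {A} {B} A-sym B-sym i j = ∑-cong λ k →
      trans (ℚ.*-comm (A j k) (B k i)) (cong₂ _*_ (B-sym i k) (A-sym k j))

  module _ {n} {A X Y : Matrix n}
           (X-inv : IsMoorePenroseInverse A X) (Y-inv : IsMoorePenroseInverse A Y) where
    private
      module X = IsMoorePenroseInverse X-inv
      module Y = IsMoorePenroseInverse Y-inv

    -- Both products are the orthogonal projection onto the column space of `A`. Since AX =
    -- (AY)(AX), transposing exchanges the two symmetric factors, and (AX)(AY) = AY.
    A⊗-unique : A ⊗ X ≈ A ⊗ Y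
    A⊗-unique i j = begin
      (A ⊗ X) i j             ≡⟨ X.AX-sym i j ⟨
      (A ⊗ X) j i             ≡⟨ ⊗-cong {B = X} Y.AXA≈A (λ _ _ → refl) j i ⟨
      (A ⊗ Y ⊗ A ⊗ X) j i     ≡⟨ ⊗-assoc (A ⊗ Y) A X j i ⟩
      (A ⊗ Y ⊗ (A ⊗ X)) j i   ≡⟨ ⊗-ᵀ Y.AX-sym X.AX-sym i j ⟩
      (A ⊗ X ⊗ (A ⊗ Y)) i j   ≡⟨ ⊗-assoc (A ⊗ X) A Y i j ⟨
      (A ⊗ X ⊗ A ⊗ Y) i j     ≡⟨ ⊗-cong {B = Y} X.AXA≈A (λ _ _ → refl) i j ⟩
      (A ⊗ Y) i j             ∎

    ⊗A-unique : X ⊗ A ≈ Y ⊗ A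
    ⊗A-unique i j = begin
      (X ⊗ A) i j             ≡⟨ X.XA-sym i j ⟨
      (X ⊗ A) j i             ≡⟨ ⊗-cong {A = X} (λ _ _ → refl) Y.AXA≈A j i ⟨
      (X ⊗ (A ⊗ Y ⊗ A)) j i   ≡⟨ ⊗-cong {A = X} (λ _ _ → refl) (⊗-assoc A Y A) j i ⟩
      (X ⊗ (A ⊗ (Y ⊗ A))) j i ≡⟨ ⊗-assoc X A (Y ⊗ A) j i ⟨
      (X ⊗ A ⊗ (Y ⊗ A)) j i   ≡⟨ ⊗-ᵀ X.XA-sym Y.XA-sym i j ⟩
      (Y ⊗ A ⊗ (X ⊗ A)) i j   ≡⟨ ⊗-assoc Y A (X ⊗ A) i j ⟩
      (Y ⊗ (A ⊗ (X ⊗ A))) i j ≡⟨ ⊗-cong {A = Y} (λ _ _ → refl) (⊗-assoc A X A) i j ⟨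
      (Y ⊗ (A ⊗ X ⊗ A)) i j   ≡⟨ ⊗-cong {A = Y} (λ _ _ → refl) X.AXA≈A i j ⟩
      (Y ⊗ A) i j             ∎

    -- X = XAX = XAY = YAY, by replacing one projection at a time.
    pseudoinverse-unique : X ≈ Y
    pseudoinverse-unique i j = begin
      X i j               ≡⟨ X.XAX≈X i j ⟨
      (X ⊗ A ⊗ X) i j     ≡⟨ ⊗-assoc X A X i j ⟩
      (X ⊗ (A ⊗ X)) i j   ≡⟨ ⊗-cong {A = X} (λ _ _ → refl) A⊗-unique i j ⟩
      (X ⊗ (A ⊗ Y)) i j   ≡⟨ ⊗-assoc X A Y i j ⟨
      (X ⊗ A ⊗ Y) i j     ≡⟨ ⊗-cong {B = Y} ⊗A-unique (λ _ _ → refl) i j ⟩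
      (Y ⊗ A ⊗ Y) i j     ≡⟨ Y.XAX≈X i j ⟩
      Y i j               ∎

  resistance-entries : ∀ {n} (P : Matrix n) i j →
                       resistance P i j ≡ (P i i - P i j) - (P j i - P j j)
  resistance-entries {n} P i j = begin
    ∑[ k < n ] ∑[ l < n ] (d k * P k l * d l)
      ≡⟨ ∑-cong {n} (λ k → trans
           (∑-cong {n} λ l → solve 3 (λ a b c → a :* b :* c := a :* (c :* b)) refl (d k) (P k l) (d l))
           (trans (∑-*ˡ (d k) (λ l → d l * P k l)) (cong (d k *_) (∑-d (P k))))) ⟩
    ∑[ k < n ] (d k * (P k i - P k j))
      ≡⟨ ∑-d (λ k → P k i - P k j) ⟩
    (P i i - P i j) - (P j i - P j j) ∎
    where
    d : Vector n
    d k = unit i k - unit j k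

    ∑-d : ∀ f → ∑[ k < n ] (d k * f k) ≡ f i - f j
    ∑-d f = begin
      ∑[ k < n ] (d k * f k)
        ≡⟨ ∑-cong {n} (λ k → solve 3 (λ a b c → (a :- b) :* c := a :* c :- b :* c) refl (unit i k) (unit j k) (f k)) ⟩
      ∑[ k < n ] (unit i k * f k - unit j k * f k)
        ≡⟨ ∑-- (λ k → unit i k * f k) (λ k → unit j k * f k) ⟩
      ∑[ k < n ] (unit i k * f k) - ∑[ k < n ] (unit j k * f k)
        ≡⟨ cong₂ _-_ (∑-unit i f) (∑-unit j f) ⟩
      f i - f j ∎

  resistance-cong : ∀ {n} {P Q : Matrix n} → P ≈ Q → ∀ i j → resistance P i j ≡ resistance Q i j
  resistance-cong {P = P} {Q} P≈Q i j = begin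
    resistance P i j
      ≡⟨ resistance-entries P i j ⟩
    (P i i - P i j) - (P j i - P j j)
      ≡⟨ cong₂ _-_ (cong₂ _-_ (P≈Q i i) (P≈Q i j)) (cong₂ _-_ (P≈Q j i) (P≈Q j j)) ⟩
    (Q i i - Q i j) - (Q j i - Q j j)
      ≡⟨ resistance-entries Q i j ⟨
    resistance Q i j ∎

  halfTotalResistance-cong : ∀ {n} {P Q : Matrix n} →
    (∀ i j → resistance P i j ≡ resistance Q i j) → halfTotalResistance P ≡ halfTotalResistance Q
  halfTotalResistance-cong P≈Q = cong (½ *_) (∑-cong λ i → ∑-cong λ j → P≈Q i j)

  -- Summing the four entries of each resistance over ordered pairs gives the trace term twice and
  -- the total of all entries twice, and the factor ½ cancels the doubling.
  halfTotalResistance-trace : ∀ {n} (P : Matrix n) →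
    halfTotalResistance P ≡ ι n * ∑[ i < n ] P i i - ∑[ i < n ] ∑[ j < n ] P i j
  halfTotalResistance-trace {n} P = begin
    ½ * (∑[ i < n ] ∑[ j < n ] resistance P i j)
      ≡⟨ cong (½ *_) (∑-cong {n} row) ⟩
    ½ * (∑[ i < n ] ((ι n * P i i - ∑[ j < n ] P i j) - (∑[ j < n ] P j i - T)))
      ≡⟨ cong (½ *_) (trans (∑-- (λ i → ι n * P i i - ∑[ j < n ] P i j) (λ i → ∑[ j < n ] P j i - T))
          (cong₂ _-_
            (trans (∑-- (λ i → ι n * P i i) (λ i → ∑[ j < n ] P i j)) (cong (_- S) (∑-*ˡ (ι n) (λ i → P i i))))
            (trans (∑-- (λ i → ∑[ j < n ] P j i) (λ _ → T))
                   (cong₂ _-_ (sym (∑-comm P)) (∑-const n T))))) ⟩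
    ½ * ((ι n * T - S) - (S - ι n * T))
      ≡⟨ solve 2 (λ a s → con ½ :* ((a :- s) :- (s :- a)) := a :- s) refl (ι n * T) S ⟩
    ι n * T - S ∎
    where
    T S : ℚ
    T = ∑[ i < n ] P i i
    S = ∑[ i < n ] ∑[ j < n ] P i j

    row : ∀ i → ∑[ j < n ] resistance P i j ≡ (ι n * P i i - ∑[ j < n ] P i j) - (∑[ j < n ] P j i - T)
    row i = begin
      ∑[ j < n ] resistance P i j
        ≡⟨ ∑-cong (resistance-entries P i) ⟩
      ∑[ j < n ] ((P i i - P i j) - (P j i - P j j))
        ≡⟨ ∑-- (λ j → P i i - P i j) (λ j → P j i - P j j) ⟩
      ∑[ j < n ] (P i i - P i j) - ∑[ j < n ] (P j i - P j j)
        ≡⟨ cong₂ _-_ (trans (∑-- (λ _ → P i i) (P i)) (cong (_- ∑[ j < n ] P i j) (∑-const n (P i i))))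
                     (∑-- (λ j → P j i) (λ j → P j j)) ⟩
      (ι n * P i i - ∑[ j < n ] P i j) - (∑[ j < n ] P j i - T) ∎

  -- If A G = I - e 1ᵀ then, with Π = I - J/N, the pseudoinverse of A is Π G Π;
  -- passing from G to Π G Π does not change resistances.
  module Centering {N : ℕ} (A G : Matrix N) (e : Vector N)
    (w : ℚ) (w*N≡1 : w * ι N ≡ 1ℚ)
    (A-sym : A ᵀ ≈ A) (G-sym : G ᵀ ≈ G)
    (A-rows : ∀ i → ∑[ k < N ] A i k ≡ 0ℚ)
    (AG≡ : ∀ i j → (A ⊗ G) i j ≡ unit i j - e i) where

    -- `w` is 1/N, so `α` consists of the row means of `G`, which by symmetry are also its column
    -- means, and `β` is the mean of all entries. `X` is thus the product Π G Π written out
    -- entrywise.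
    α : Vector N
    α i = w * ∑[ k < N ] G i k

    β : ℚ
    β = w * ∑[ i < N ] α i

    X : Matrix N
    X i j = G i j - α i - α j + β

    X-sym : X ᵀ ≈ X
    X-sym i j = trans (cong (λ g → g - α j - α i + β) (G-sym i j))
      (solve 4 (λ g a b c → g :- a :- b :+ c := g :- b :- a :+ c) refl (G i j) (α j) (α i) β)

    -- Averaging the columns of `A ⊗ G` averages `unit i j - e i` over j.
    Aα : ∀ i → ∑[ k < N ] (A i k * α k) ≡ w - e i
    Aα i = begin
      ∑[ k < N ] (A i k * (w * ∑[ j < N ] G k j))
        ≡⟨ ∑-cong {N} (λ k → trans
             (solve 3 (λ a b c → a :* (b :* c) := b :* (a :* c)) refl (A i k) w (∑[ j < N ] G k j))
             (cong (w *_) (sym (∑-*ˡ (A i k) (G k))))) ⟩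
      ∑[ k < N ] (w * ∑[ j < N ] (A i k * G k j))
        ≡⟨ ∑-*ˡ w (λ k → ∑[ j < N ] (A i k * G k j)) ⟩
      w * ∑[ k < N ] ∑[ j < N ] (A i k * G k j)
        ≡⟨ cong (w *_) (∑-comm (λ k j → A i k * G k j)) ⟩
      w * ∑[ j < N ] (A ⊗ G) i j
        ≡⟨ cong (w *_) (trans (∑-cong (AG≡ i)) (trans (∑-- (unit i) (λ _ → e i))
             (cong₂ _-_ (∑-unit-1 i) (∑-const N (e i))))) ⟩
      w * (1ℚ - ι N * e i)
        ≡⟨ solve 3 (λ w n e → w :* (con 1ℚ :- n :* e) := w :- w :* n :* e) refl w (ι N) (e i) ⟩
      w - w * ι N * e i
        ≡⟨ cong (λ z → w - z) (trans (cong (_* e i) w*N≡1) (ℚ.*-identityˡ (e i))) ⟩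
      w - e i ∎

    -- The grounding vector `e` occurs in both AG and Aα and cancels. What is constant in the
    -- summation index is annihilated by the zero row sums, so AX is the projection Π.
    AX≡ : ∀ i j → (A ⊗ X) i j ≡ unit i j - w
    AX≡ i j = begin
      ∑[ k < N ] (A i k * (G k j - α k - α j + β))
        ≡⟨ ∑-cong {N} (λ k → solve 5 (λ a g x y b → a :* (g :- x :- y :+ b) := (a :* g :- a :* x) :+ a :* (b :- y)) refl
             (A i k) (G k j) (α k) (α j) β) ⟩
      ∑[ k < N ] ((A i k * G k j - A i k * α k) + A i k * (β - α j))
        ≡⟨ trans (∑-+ (λ k → A i k * G k j - A i k * α k) (λ k → A i k * (β - α j)))
             (cong₂ _+_ (∑-- (λ k → A i k * G k j) (λ k → A i k * α k)) (∑-*ʳ (A i) (β - α j))) ⟩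
      ((A ⊗ G) i j - ∑[ k < N ] (A i k * α k)) + (∑[ k < N ] A i k) * (β - α j)
        ≡⟨ cong₂ (λ p q → p + q * (β - α j)) (cong₂ _-_ (AG≡ i j) (Aα i)) (A-rows i) ⟩
      ((unit i j - e i) - (w - e i)) + 0ℚ * (β - α j)
        ≡⟨ solve 4 (λ u e w b → ((u :- e) :- (w :- e)) :+ con 0ℚ :* b := u :- w) refl (unit i j) (e i) w (β - α j) ⟩
      unit i j - w ∎

    XA≡ : ∀ i j → (X ⊗ A) i j ≡ unit i j - w
    XA≡ i j = begin
      (X ⊗ A) i j  ≡⟨ ⊗-ᵀ A-sym X-sym i j ⟨
      (A ⊗ X) j i  ≡⟨ AX≡ j i ⟩
      unit j i - w ≡⟨ cong (_- w) (unit-sym j i) ⟩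
      unit i j - w ∎

    X-cols : ∀ j → ∑[ k < N ] X k j ≡ 0ℚ
    X-cols j = begin
      ∑[ k < N ] (G k j - α k - α j + β)
        ≡⟨ ∑-cong {N} (λ k → trans (cong (λ g → g - α k - α j + β) (G-sym j k))
             (solve 4 (λ g a b c → g :- a :- b :+ c := (g :- a) :+ (c :- b)) refl (G j k) (α k) (α j) β)) ⟩
      ∑[ k < N ] ((G j k - α k) + (β - α j))
        ≡⟨ trans (∑-+ (λ k → G j k - α k) (λ _ → β - α j)) (cong₂ _+_ (∑-- (G j) α) (∑-const N (β - α j))) ⟩
      (g - a) + ι N * (w * a - w * g)
        ≡⟨ solve 4 (λ g a n w → (g :- a) :+ n :* (w :* a :- w :* g) := (con 1ℚ :- w :* n) :* (g :- a)) refl g a (ι N) w ⟩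
      (1ℚ - w * ι N) * (g - a)
        ≡⟨ cong (λ z → (1ℚ - z) * (g - a)) w*N≡1 ⟩
      0ℚ * (g - a)
        ≡⟨ ℚ.*-zeroˡ (g - a) ⟩
      0ℚ ∎
      where
      g a : ℚ
      g = ∑[ k < N ] G j k
      a = ∑[ k < N ] α k

    -- `M` is Π, which fixes every vector of sum zero. This yields the first two Penrose equations,
    -- with `B` taken to be `A` and then `X`.
    centered-⊗ : ∀ {M B : Matrix N} → (∀ i j → M i j ≡ unit i j - w) → (∀ j → ∑[ k < N ] B k j ≡ 0ℚ) → M ⊗ B ≈ B
    centered-⊗ {M} {B} M≡ B-cols i j = begin
      ∑[ k < N ] (M i k * B k j)
        ≡⟨ ∑-cong {N} (λ k → trans (cong (_* B k j) (M≡ i k))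
             (solve 3 (λ u w b → (u :- w) :* b := u :* b :- w :* b) refl (unit i k) w (B k j))) ⟩
      ∑[ k < N ] (unit i k * B k j - w * B k j)
        ≡⟨ trans (∑-- (λ k → unit i k * B k j) (λ k → w * B k j))
             (cong₂ _-_ (∑-unit i (λ k → B k j)) (trans (∑-*ˡ w (λ k → B k j)) (cong (w *_) (B-cols j)))) ⟩
      B i j - w * 0ℚ
        ≡⟨ solve 2 (λ b w → b :- w :* con 0ℚ := b) refl (B i j) w ⟩
      B i j ∎

    centered-sym : ∀ {M : Matrix N} → (∀ i j → M i j ≡ unit i j - w) → M ᵀ ≈ M
    centered-sym M≡ i j = trans (M≡ j i) (trans (cong (_- w) (unit-sym j i)) (sym (M≡ i j)))

    X-inverse : IsMoorePenroseInverse A X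
    X-inverse = record
      { AXA≈A  = centered-⊗ AX≡ λ j → trans (∑-cong λ k → A-sym j k) (A-rows j)
      ; XAX≈X  = centered-⊗ XA≡ X-cols
      ; AX-sym = centered-sym AX≡
      ; XA-sym = centered-sym XA≡
      }

    -- In the alternating sum of four entries, terms depending on the row alone or on the column
    -- alone cancel.
    resistance-X : ∀ i j → resistance X i j ≡ resistance G i j
    resistance-X i j = begin
      resistance X i j
        ≡⟨ resistance-entries X i j ⟩
      (X i i - X i j) - (X j i - X j j)
        ≡⟨ solve 7 (λ p q r s a b c → ((p :- a :- a :+ c) :- (q :- a :- b :+ c)) :- ((r :- b :- a :+ c) :- (s :- b :- b :+ c))
             := (p :- q) :- (r :- s)) refl (G i i) (G i j) (G j i) (G j j) (α i) (α j) β ⟩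
      (G i i - G i j) - (G j i - G j j)
        ≡⟨ resistance-entries G i j ⟨
      resistance G i j ∎

    trace-formula : ∀ L⁺ → IsMoorePenroseInverse A L⁺ →
      halfTotalResistance L⁺ ≡ ι N * ∑[ i < N ] G i i - ∑[ i < N ] ∑[ j < N ] G i j
    trace-formula L⁺ L⁺-inv = begin
      halfTotalResistance L⁺
        ≡⟨ halfTotalResistance-cong (λ i j →
             trans (resistance-cong (pseudoinverse-unique L⁺-inv X-inverse) i j) (resistance-X i j)) ⟩
      halfTotalResistance G
        ≡⟨ halfTotalResistance-trace G ⟩
      ι N * ∑[ i < N ] G i i - ∑[ i < N ] ∑[ j < N ] G i j ∎

  -- Sums of integers

  ⅙ : ℚ
  ⅙ = ℤ.+ 1 / 6

  ∑-toℕ : ∀ n → ∑[ j < n ] ι (toℕ j) ≡ ½ * (ι n * (ι n - 1ℚ))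
  ∑-toℕ zero    = refl
  ∑-toℕ (suc n) = begin
    0ℚ + ∑[ j < n ] ι (suc (toℕ j))
      ≡⟨ cong (0ℚ +_) (trans (∑-cong {n} (λ j → ι-suc (toℕ j))) (trans (∑-+ {n} (λ _ → 1ℚ) (λ j → ι (toℕ j)))
           (cong₂ _+_ (∑-const n 1ℚ) (∑-toℕ n)))) ⟩
    0ℚ + (ι n * 1ℚ + ½ * (ι n * (ι n - 1ℚ)))
      ≡⟨ solve 1 (λ x → con 0ℚ :+ (x :* con 1ℚ :+ con ½ :* (x :* (x :- con 1ℚ)))
           := con ½ :* ((con 1ℚ :+ x) :* ((con 1ℚ :+ x) :- con 1ℚ))) refl (ι n) ⟩
    ½ * ((1ℚ + ι n) * ((1ℚ + ι n) - 1ℚ))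
      ≡⟨ cong (λ x → ½ * (x * (x - 1ℚ))) (ι-suc n) ⟨
    ½ * (ι (suc n) * (ι (suc n) - 1ℚ)) ∎

  ∑-toℕ² : ∀ n → ∑[ j < n ] (ι (toℕ j) * ι (toℕ j)) ≡ ⅙ * (ι n * (ι n - 1ℚ) * (ι n + ι n - 1ℚ))
  ∑-toℕ² zero    = refl
  ∑-toℕ² (suc n) = begin
    0ℚ + ∑[ j < n ] (ι (suc (toℕ j)) * ι (suc (toℕ j)))
      ≡⟨ cong (0ℚ +_) (∑-cong {n} (λ j → trans (cong (λ x → x * x) (ι-suc (toℕ j)))
           (solve 1 (λ x → (con 1ℚ :+ x) :* (con 1ℚ :+ x) := con 1ℚ :+ (x :+ x) :+ x :* x) refl (ι (toℕ j))))) ⟩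
    0ℚ + ∑[ j < n ] (1ℚ + (ι (toℕ j) + ι (toℕ j)) + ι (toℕ j) * ι (toℕ j))
      ≡⟨ cong (0ℚ +_) (trans (∑-+ {n} (λ j → 1ℚ + (ι (toℕ j) + ι (toℕ j))) (λ j → ι (toℕ j) * ι (toℕ j)))
           (cong₂ _+_ (trans (∑-+ {n} (λ _ → 1ℚ) (λ j → ι (toℕ j) + ι (toℕ j)))
                        (cong₂ _+_ (∑-const n 1ℚ) (trans (∑-+ {n} (λ j → ι (toℕ j)) (λ j → ι (toℕ j))) (cong (λ x → x + x) (∑-toℕ n)))))
                      (∑-toℕ² n))) ⟩
    0ℚ + (ι n * 1ℚ + (½ * (ι n * (ι n - 1ℚ)) + ½ * (ι n * (ι n - 1ℚ))) + ⅙ * (ι n * (ι n - 1ℚ) * (ι n + ι n - 1ℚ)))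
      ≡⟨ solve 1 (λ x → con 0ℚ :+ (x :* con 1ℚ :+ (con ½ :* (x :* (x :- con 1ℚ)) :+ con ½ :* (x :* (x :- con 1ℚ)))
                           :+ con ⅙ :* (x :* (x :- con 1ℚ) :* (x :+ x :- con 1ℚ)))
           := con ⅙ :* ((con 1ℚ :+ x) :* ((con 1ℚ :+ x) :- con 1ℚ) :* ((con 1ℚ :+ x) :+ (con 1ℚ :+ x) :- con 1ℚ))) refl (ι n) ⟩
    ⅙ * ((1ℚ + ι n) * ((1ℚ + ι n) - 1ℚ) * ((1ℚ + ι n) + (1ℚ + ι n) - 1ℚ))
      ≡⟨ cong (λ x → ⅙ * (x * (x - 1ℚ) * (x + x - 1ℚ))) (ι-suc n) ⟨
    ⅙ * (ι (suc n) * (ι (suc n) - 1ℚ) * (ι (suc n) + ι (suc n) - 1ℚ)) ∎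

  ∑-⊓ : ∀ {i n} → i ℕ.≤ n → ∑[ j < n ] ι (i ⊓ toℕ j) ≡ ι i * ι n - ½ * (ι i * (1ℚ + ι i))
  ∑-⊓ {n = n} z≤n = trans (∑-0 n) (solve 1 (λ x → con 0ℚ := con 0ℚ :* x :- con ½ :* (con 0ℚ :* (con 1ℚ :+ con 0ℚ))) refl (ι n))
  ∑-⊓ {suc i} {suc n} (s≤s i≤n) = begin
    0ℚ + ∑[ j < n ] ι (suc (i ⊓ toℕ j))
      ≡⟨ cong (0ℚ +_) (trans (∑-cong {n} (λ j → ι-suc (i ⊓ toℕ j))) (trans (∑-+ {n} (λ _ → 1ℚ) (λ j → ι (i ⊓ toℕ j)))
           (cong₂ _+_ (∑-const n 1ℚ) (∑-⊓ i≤n)))) ⟩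
    0ℚ + (ι n * 1ℚ + (ι i * ι n - ½ * (ι i * (1ℚ + ι i))))
      ≡⟨ solve 2 (λ i n → con 0ℚ :+ (n :* con 1ℚ :+ (i :* n :- con ½ :* (i :* (con 1ℚ :+ i))))
           := (con 1ℚ :+ i) :* (con 1ℚ :+ n) :- con ½ :* ((con 1ℚ :+ i) :* (con 1ℚ :+ (con 1ℚ :+ i)))) refl (ι i) (ι n) ⟩
    (1ℚ + ι i) * (1ℚ + ι n) - ½ * ((1ℚ + ι i) * (1ℚ + (1ℚ + ι i)))
      ≡⟨ cong₂ (λ x y → x * y - ½ * (x * (1ℚ + x))) (ι-suc i) (ι-suc n) ⟨
    ι (suc i) * ι (suc n) - ½ * (ι (suc i) * (1ℚ + ι (suc i))) ∎

  telescope : ∀ n (f : ℕ → ℚ) → ∑[ i < n ] (f (toℕ i) - f (suc (toℕ i))) ≡ f 0 - f n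
  telescope zero    f = sym (ℚ.+-inverseʳ (f 0))
  telescope (suc n) f = trans (cong ((f 0 - f 1) +_) (telescope n (λ k → f (suc k))))
    (solve 3 (λ a b c → (a :- b) :+ (b :- c) := a :- c) refl (f 0) (f 1) (f (suc n)))

  -- Up to sign the discrete derivative of i ↦ `i ⊓ k` (see `below-⊓`). As a weight it cuts a
  -- telescoping sum off at `k`.
  below : ℕ → ℕ → ℚ
  below k i = if i ℕ.<ᵇ k then 1ℚ else 0ℚ

  below-irrefl : ∀ i → below i i ≡ 0ℚ
  below-irrefl zero    = refl
  below-irrefl (suc i) = below-irrefl i

  below-⊓ : ∀ i k → ι (i ⊓ k) - ι (suc i ⊓ k) ≡ - below k i
  below-⊓ zero    zero    = refl
  below-⊓ (suc i) zero    = refl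
  below-⊓ zero    (suc k) = refl
  below-⊓ (suc i) (suc k) = begin
    ι (suc (i ⊓ k)) - ι (suc (suc i ⊓ k))
      ≡⟨ cong₂ _-_ (ι-suc (i ⊓ k)) (ι-suc (suc i ⊓ k)) ⟩
    (1ℚ + ι (i ⊓ k)) - (1ℚ + ι (suc i ⊓ k))
      ≡⟨ solve 2 (λ a b → (con 1ℚ :+ a) :- (con 1ℚ :+ b) := a :- b) refl (ι (i ⊓ k)) (ι (suc i ⊓ k)) ⟩
    ι (i ⊓ k) - ι (suc i ⊓ k)
      ≡⟨ below-⊓ i k ⟩
    - below k i ∎

  telescope-below : ∀ {k n} → k ℕ.≤ n → (f : ℕ → ℚ) →
    ∑[ i < n ] (below k (toℕ i) * (f (toℕ i) - f (suc (toℕ i)))) ≡ f 0 - f k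
  telescope-below {n = n} z≤n f = trans
    (trans (∑-cong {n} (λ i → ℚ.*-zeroˡ (f (toℕ i) - f (suc (toℕ i))))) (∑-0 n))
    (sym (ℚ.+-inverseʳ (f 0)))
  telescope-below {suc k} (s≤s k≤n) f = trans
    (cong (1ℚ * (f 0 - f 1) +_) (telescope-below k≤n (λ k → f (suc k))))
    (solve 3 (λ a b c → con 1ℚ :* (a :- b) :+ (b :- c) := a :- c) refl (f 0) (f 1) (f (suc k)))

  -- The cycle

  data NextView {n} (i : Fin n) : Set where
    step : suc (toℕ i) ℕ.< n → toℕ (next i) ≡ suc (toℕ i) → NextView i
    wrap : suc (toℕ i) ≡ n → toℕ (next i) ≡ 0 → NextView i

  nextView : ∀ {n} (i : Fin n) → NextView i
  nextView {suc n} i with ℕ.m≤n⇒m<n∨m≡n (toℕ<n i)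
  ... | inj₁ 1+i<1+n = step 1+i<1+n
    (trans (toℕ-fromℕ< (m%n<n (suc (toℕ i)) (suc n))) (m<n⇒m%n≡m 1+i<1+n))
  ... | inj₂ 1+i≡1+n = wrap 1+i≡1+n
    (trans (toℕ-fromℕ< (m%n<n (suc (toℕ i)) (suc n)))
    (trans (cong (ℕ._% suc n) 1+i≡1+n) (n%n≡0 (suc n))))

  next-injective : ∀ {n} {i j : Fin n} → next i ≡ next j → i ≡ j
  next-injective {i = i} {j} eq with nextView i | nextView j
  ... | step _ p | step _ q = toℕ-injective (ℕ.suc-injective (trans (sym p) (trans (cong toℕ eq) q)))
  ... | step _ p | wrap _ q = contradiction (trans (sym p) (trans (cong toℕ eq) q)) λ ()
  ... | wrap _ p | step _ q = contradiction (trans (sym p) (trans (cong toℕ eq) q)) λ ()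
  ... | wrap p _ | wrap q _ = toℕ-injective (ℕ.suc-injective (trans p (sym q)))

  -- Without a wrap the index has grown by two; a return that uses a wrap forces n ≤ 2.
  next²≢ : ∀ {n} → 2 ℕ.< n → (i : Fin n) → next (next i) ≢ i
  next²≢ 2<n i eq with nextView i | nextView (next i)
  ... | step _ p | step _ q = ℕ.<⇒≢ (ℕ.m<n⇒m<1+n (ℕ.n<1+n (toℕ i)))
    (trans (sym (cong toℕ eq)) (trans q (cong suc p)))
  ... | step _ p | wrap q z = ℕ.<⇒≢ 2<n
    (trans (cong (λ t → suc (suc t)) (trans (sym z) (cong toℕ eq))) (trans (cong suc (sym p)) q))
  ... | wrap p z | step _ q = ℕ.<⇒≢ 2<n
    (trans (cong suc (trans (cong suc (sym z)) (trans (sym q) (cong toℕ eq)))) p)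
  ... | wrap p z | wrap q _ = ℕ.<⇒≢ (ℕ.<-trans (ℕ.n<1+n 1) 2<n) (trans (cong suc (sym z)) q)

  -- Lets the closing edge of the cycle be treated as an ordinary step from n - 1 to n.
  toℕ-next : ∀ {n} {A : Set} (f : ℕ → A) → f 0 ≡ f n → (i : Fin n) → f (toℕ (next i)) ≡ f (suc (toℕ i))
  toℕ-next f f0≡fn i with nextView i
  ... | step _ p = cong f p
  ... | wrap p q = trans (cong f q) (trans f0≡fn (cong f (sym p)))

  module _ {n-1 : ℕ} where
    private
      n = suc n-1

    -- Unrolls the cycle onto ℕ, so that sums of differences around it become telescoping sums from
    -- 0 to n.
    periodic : Vector n → ℕ → ℚ
    periodic f k = f (k mod n)

    periodic-toℕ : ∀ f (i : Fin n) → f i ≡ periodic f (toℕ i)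
    periodic-toℕ f i = cong f (toℕ-injective
      (sym (trans (toℕ-fromℕ< (m%n<n (toℕ i) n)) (m<n⇒m%n≡m (toℕ<n i)))))

    periodic-n : ∀ f → periodic f n ≡ f zero
    periodic-n f = cong f (toℕ-injective (trans (toℕ-fromℕ< (m%n<n n n)) (n%n≡0 n)))

    ∑-differences : (f : Vector n) → ∑[ i < n ] (f i - f (next i)) ≡ 0ℚ
    ∑-differences f = begin
      ∑[ i < n ] (f i - f (next i))
        ≡⟨ ∑-cong (λ i → cong (_- f (next i)) (periodic-toℕ f i)) ⟩
      ∑[ i < n ] (periodic f (toℕ i) - periodic f (suc (toℕ i)))
        ≡⟨ telescope n (periodic f) ⟩
      f zero - periodic f n
        ≡⟨ cong (λ z → f zero - z) (periodic-n f) ⟩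
      f zero - f zero
        ≡⟨ ℚ.+-inverseʳ (f zero) ⟩
      0ℚ ∎

    ∑-next : (f : Vector n) → ∑[ i < n ] f (next i) ≡ ∑[ i < n ] f i
    ∑-next f = begin
      b              ≡⟨ solve 2 (λ a b → b := a :- (a :- b)) refl a b ⟩
      a - (a - b)    ≡⟨ cong (λ z → a - z) (trans (sym (∑-- f (λ i → f (next i)))) (∑-differences f)) ⟩
      a - 0ℚ         ≡⟨ solve 1 (λ a → a :- con 0ℚ := a) refl a ⟩
      a              ∎
      where
      a b : ℚ
      a = ∑[ i < n ] f i
      b = ∑[ i < n ] f (next i)

    -- C is the Green function of the Laplacian of the n-cycle, grounded at vertex 0.
    module Cycle (s : ℚ) (s*n≡1 : s * ι n ≡ 1ℚ) where

      -- With `s` = 1/n this is min(i,k) - ik/n, the Green function of the negative second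
      -- difference on 0, ..., n with value zero at both ends. It takes natural numbers so that `n`
      -- can serve as a second name of vertex 0.
      green : ℕ → ℕ → ℚ
      green i k = ι (i ⊓ k) - s * (ι i * ι k)

      C : Matrix n
      C i k = green (toℕ i) (toℕ k)

      C-sym : ∀ i k → C i k ≡ C k i
      C-sym i k = cong₂ _-_ (cong ι (ℕ.⊓-comm (toℕ i) (toℕ k))) (cong (s *_) (ℚ.*-comm (ι (toℕ i)) (ι (toℕ k))))

      green-n : ∀ (k : Fin n) → green 0 (toℕ k) ≡ green n (toℕ k)
      green-n k = begin
        0ℚ - s * (0ℚ * ι (toℕ k))
          ≡⟨ solve 2 (λ s k → con 0ℚ :- s :* (con 0ℚ :* k) := k :- con 1ℚ :* k) refl s (ι (toℕ k)) ⟩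
        ι (toℕ k) - 1ℚ * ι (toℕ k)
          ≡⟨ cong (λ z → ι (toℕ k) - z * ι (toℕ k)) s*n≡1 ⟨
        ι (toℕ k) - s * ι n * ι (toℕ k)
          ≡⟨ cong₂ _-_ (cong ι (sym (ℕ.m≥n⇒m⊓n≡n (toℕ≤n k)))) (ℚ.*-assoc s (ι n) (ι (toℕ k))) ⟩
        ι (n ⊓ toℕ k) - s * (ι n * ι (toℕ k)) ∎

      C-next : ∀ i k → C i k - C (next i) k ≡ s * ι (toℕ k) - below (toℕ k) (toℕ i)
      C-next i k = begin
        C i k - C (next i) k
          ≡⟨ cong (λ z → C i k - z) (toℕ-next (λ j → green j (toℕ k)) (green-n k) i) ⟩
        (ι (a ⊓ b) - s * (ι a * ι b)) - (ι (suc a ⊓ b) - s * (ι (suc a) * ι b))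
          ≡⟨ cong (λ z → (ι (a ⊓ b) - s * (ι a * ι b)) - (ι (suc a ⊓ b) - s * (z * ι b))) (ι-suc a) ⟩
        (ι (a ⊓ b) - s * (ι a * ι b)) - (ι (suc a ⊓ b) - s * ((1ℚ + ι a) * ι b))
          ≡⟨ solve 5 (λ p q a b s → (p :- s :* (a :* b)) :- (q :- s :* ((con 1ℚ :+ a) :* b)) := s :* b :+ (p :- q)) refl
               (ι (a ⊓ b)) (ι (suc a ⊓ b)) (ι a) (ι b) s ⟩
        s * ι b + (ι (a ⊓ b) - ι (suc a ⊓ b))
          ≡⟨ cong (s * ι b +_) (below-⊓ a b) ⟩
        s * ι b - below b a ∎
        where
        a b : ℕ
        a = toℕ i
        b = toℕ k

      -- The weak form of "the Laplacian of C(·,k) is a unit source at k minus one at 0", with test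
      -- function `h`. The slope of C(·,k) is a constant minus `below`: the constant sums to zero
      -- around the cycle, and the step telescopes from 0 to k.
      green-identity : ∀ (h : Vector n) k →
        ∑[ i < n ] ((C i k - C (next i) k) * (h i - h (next i))) ≡ h k - h zero
      green-identity h k = begin
        ∑[ i < n ] ((C i k - C (next i) k) * (h i - h (next i)))
          ≡⟨ ∑-cong {n} (λ i → trans (cong (_* (h i - h (next i))) (C-next i k))
               (solve 3 (λ a b c → (a :- b) :* c := a :* c :- b :* c) refl c (below (toℕ k) (toℕ i)) (h i - h (next i)))) ⟩
        ∑[ i < n ] (c * (h i - h (next i)) - below (toℕ k) (toℕ i) * (h i - h (next i)))
          ≡⟨ ∑-- (λ i → c * (h i - h (next i))) (λ i → below (toℕ k) (toℕ i) * (h i - h (next i))) ⟩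
        ∑[ i < n ] (c * (h i - h (next i))) - ∑[ i < n ] (below (toℕ k) (toℕ i) * (h i - h (next i)))
          ≡⟨ cong₂ _-_ (trans (∑-*ˡ c (λ i → h i - h (next i))) (cong (c *_) (∑-differences h)))
               (trans (∑-cong (λ i → cong (λ z → below (toℕ k) (toℕ i) * (z - h (next i))) (periodic-toℕ h i)))
                      (telescope-below (toℕ≤n k) (periodic h))) ⟩
        c * 0ℚ - (h zero - periodic h (toℕ k))
          ≡⟨ cong (λ z → c * 0ℚ - (h zero - z)) (periodic-toℕ h k) ⟨
        c * 0ℚ - (h zero - h k)
          ≡⟨ solve 3 (λ c a b → c :* con 0ℚ :- (a :- b) := b :- a) refl c (h zero) (h k) ⟩
        h k - h zero ∎
        where
        c : ℚ
        c = s * ι (toℕ k)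

      C-row : ∀ i → ∑[ k < n ] C i k ≡ ½ * (ι (toℕ i) * (ι n - ι (toℕ i)))
      C-row i = begin
        ∑[ k < n ] (ι (toℕ i ⊓ toℕ k) - s * (a * ι (toℕ k)))
          ≡⟨ ∑-- {n} (λ k → ι (toℕ i ⊓ toℕ k)) (λ k → s * (a * ι (toℕ k))) ⟩
        ∑[ k < n ] ι (toℕ i ⊓ toℕ k) - ∑[ k < n ] (s * (a * ι (toℕ k)))
          ≡⟨ cong₂ _-_ (∑-⊓ (toℕ≤n i)) (trans (∑-*ˡ {n} s (λ k → a * ι (toℕ k)))
               (cong (s *_) (trans (∑-*ˡ {n} a (λ k → ι (toℕ k))) (cong (a *_) (∑-toℕ n))))) ⟩
        (a * ι n - ½ * (a * (1ℚ + a))) - s * (a * (½ * (ι n * (ι n - 1ℚ))))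
          ≡⟨ solve 3 (λ a n s → (a :* n :- con ½ :* (a :* (con 1ℚ :+ a))) :- s :* (a :* (con ½ :* (n :* (n :- con 1ℚ))))
               := (a :* n :- con ½ :* (a :* (con 1ℚ :+ a))) :- (s :* n) :* (con ½ :* (a :* (n :- con 1ℚ)))) refl a (ι n) s ⟩
        (a * ι n - ½ * (a * (1ℚ + a))) - (s * ι n) * (½ * (a * (ι n - 1ℚ)))
          ≡⟨ cong (λ z → (a * ι n - ½ * (a * (1ℚ + a))) - z * (½ * (a * (ι n - 1ℚ)))) s*n≡1 ⟩
        (a * ι n - ½ * (a * (1ℚ + a))) - 1ℚ * (½ * (a * (ι n - 1ℚ)))
          ≡⟨ solve 2 (λ a n → (a :* n :- con ½ :* (a :* (con 1ℚ :+ a))) :- con 1ℚ :* (con ½ :* (a :* (n :- con 1ℚ)))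
               := con ½ :* (a :* (n :- a))) refl a (ι n) ⟩
        ½ * (a * (ι n - a)) ∎
        where
        a : ℚ
        a = ι (toℕ i)

      C-total : ∑[ i < n ] ∑[ k < n ] C i k ≡ ½ * ⅙ * (ι n * (ι n - 1ℚ) * (ι n + 1ℚ))
      C-total = begin
        ∑[ i < n ] ∑[ k < n ] C i k
          ≡⟨ ∑-cong {n} (λ i → trans (C-row i)
               (solve 2 (λ a n → con ½ :* (a :* (n :- a)) := con ½ :* (n :* a :- a :* a)) refl (ι (toℕ i)) (ι n))) ⟩
        ∑[ i < n ] (½ * (ι n * ι (toℕ i) - ι (toℕ i) * ι (toℕ i)))
          ≡⟨ trans (∑-*ˡ {n} ½ (λ i → ι n * ι (toℕ i) - ι (toℕ i) * ι (toℕ i))) (cong (½ *_)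
               (trans (∑-- {n} (λ i → ι n * ι (toℕ i)) (λ i → ι (toℕ i) * ι (toℕ i)))
                 (cong₂ _-_ (trans (∑-*ˡ {n} (ι n) (λ i → ι (toℕ i))) (cong (ι n *_) (∑-toℕ n))) (∑-toℕ² n)))) ⟩
        ½ * (ι n * (½ * (ι n * (ι n - 1ℚ))) - ⅙ * (ι n * (ι n - 1ℚ) * (ι n + ι n - 1ℚ)))
          ≡⟨ solve 1 (λ n → con ½ :* (n :* (con ½ :* (n :* (n :- con 1ℚ))) :- con ⅙ :* (n :* (n :- con 1ℚ) :* (n :+ n :- con 1ℚ)))
               := con ½ :* con ⅙ :* (n :* (n :- con 1ℚ) :* (n :+ con 1ℚ))) refl (ι n) ⟩
        ½ * ⅙ * (ι n * (ι n - 1ℚ) * (ι n + 1ℚ)) ∎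

      -- The diagonal entry i(n-i)/n is 2/n times the row sum i(n-i)/2, so the trace can be read off
      -- from `C-total`.
      C-trace : ∑[ i < n ] C i i ≡ ⅙ * ((ι n - 1ℚ) * (ι n + 1ℚ))
      C-trace = begin
        ∑[ i < n ] C i i
          ≡⟨ ∑-cong {n} diagonal ⟩
        ∑[ i < n ] ((s + s) * ∑[ k < n ] C i k)
          ≡⟨ ∑-*ˡ (s + s) (λ i → ∑[ k < n ] C i k) ⟩
        (s + s) * ∑[ i < n ] ∑[ k < n ] C i k
          ≡⟨ cong ((s + s) *_) C-total ⟩
        (s + s) * (½ * ⅙ * (ι n * (ι n - 1ℚ) * (ι n + 1ℚ)))
          ≡⟨ solve 2 (λ s n → (s :+ s) :* (con ½ :* con ⅙ :* (n :* (n :- con 1ℚ) :* (n :+ con 1ℚ)))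
               := (s :* n) :* (con ⅙ :* ((n :- con 1ℚ) :* (n :+ con 1ℚ)))) refl s (ι n) ⟩
        (s * ι n) * (⅙ * ((ι n - 1ℚ) * (ι n + 1ℚ)))
          ≡⟨ trans (cong (_* (⅙ * ((ι n - 1ℚ) * (ι n + 1ℚ)))) s*n≡1) (ℚ.*-identityˡ _) ⟩
        ⅙ * ((ι n - 1ℚ) * (ι n + 1ℚ)) ∎
        where
        diagonal : ∀ i → C i i ≡ (s + s) * ∑[ k < n ] C i k
        diagonal i = begin
          ι (toℕ i ⊓ toℕ i) - s * (a * a)
            ≡⟨ cong (λ z → ι z - s * (a * a)) (ℕ.⊓-idem (toℕ i)) ⟩
          a - s * (a * a)
            ≡⟨ cong (_- s * (a * a)) (trans (sym (ℚ.*-identityˡ a)) (cong (_* a) (sym s*n≡1))) ⟩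
          s * ι n * a - s * (a * a)
            ≡⟨ solve 3 (λ s n a → s :* n :* a :- s :* (a :* a) := (s :+ s) :* (con ½ :* (a :* (n :- a)))) refl s (ι n) a ⟩
          (s + s) * (½ * (a * (ι n - a)))
            ≡⟨ cong ((s + s) *_) (C-row i) ⟨
          (s + s) * ∑[ k < n ] C i k ∎
          where
          a : ℚ
          a = ι (toℕ i)

      -- Since `below` is strict, the slope of C(·,i) on the edge leaving i is just `s` times i.
      C-trace-next : ∑[ i < n ] C (next i) i ≡ ∑[ i < n ] C i i - ½ * (ι n - 1ℚ)
      C-trace-next = begin
        ∑[ i < n ] C (next i) i
          ≡⟨ ∑-cong {n} (λ i → trans (solve 2 (λ a b → b := a :- (a :- b)) refl (C i i) (C (next i) i))
               (cong (λ z → C i i - z) (trans (C-next i i) (trans (cong (λ z → s * ι (toℕ i) - z) (below-irrefl (toℕ i)))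
                 (solve 1 (λ a → a :- con 0ℚ := a) refl (s * ι (toℕ i))))))) ⟩
        ∑[ i < n ] (C i i - s * ι (toℕ i))
          ≡⟨ trans (∑-- {n} (λ i → C i i) (λ i → s * ι (toℕ i))) (cong (λ z → ∑[ i < n ] C i i - z)
               (trans (∑-*ˡ {n} s (λ i → ι (toℕ i))) (cong (s *_) (∑-toℕ n)))) ⟩
        ∑[ i < n ] C i i - s * (½ * (ι n * (ι n - 1ℚ)))
          ≡⟨ cong (λ z → ∑[ i < n ] C i i - z)
               (trans (solve 2 (λ s n → s :* (con ½ :* (n :* (n :- con 1ℚ))) := (s :* n) :* (con ½ :* (n :- con 1ℚ))) refl s (ι n))
                 (trans (cong (_* (½ * (ι n - 1ℚ))) s*n≡1) (ℚ.*-identityˡ _))) ⟩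
        ∑[ i < n ] C i i - ½ * (ι n - 1ℚ) ∎

  -- Iverson brackets

  ⟦_⟧ : ∀ {P : Set} → Dec P → ℚ
  ⟦ p ⟧ = if does p then 1ℚ else 0ℚ

  ⟦⟧-cong : ∀ {P Q : Set} → (P → Q) → (Q → P) → (p : Dec P) (q : Dec Q) → ⟦ p ⟧ ≡ ⟦ q ⟧
  ⟦⟧-cong f g (yes p) (yes q) = refl
  ⟦⟧-cong f g (yes p) (no ¬q) = contradiction (f p) ¬q
  ⟦⟧-cong f g (no ¬p) (yes q) = contradiction (g q) ¬p
  ⟦⟧-cong f g (no ¬p) (no ¬q) = refl

  ⟦⟧-× : ∀ {P Q : Set} (p : Dec P) (q : Dec Q) → ⟦ p ×-dec q ⟧ ≡ ⟦ p ⟧ * ⟦ q ⟧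
  ⟦⟧-× (yes _) q = sym (ℚ.*-identityˡ ⟦ q ⟧)
  ⟦⟧-× (no _)  q = sym (ℚ.*-zeroˡ ⟦ q ⟧)

  ⟦⟧-¬ : ∀ {P : Set} (p : Dec P) → ⟦ ¬? p ⟧ ≡ 1ℚ - ⟦ p ⟧
  ⟦⟧-¬ (yes _) = refl
  ⟦⟧-¬ (no _)  = refl

  -- A unique witness makes the family of brackets a unit vector. This turns the existential
  -- adjacency of the flower into a sum.
  ⟦⟧-any : ∀ {n} {P : Fin n → Set} (P? : ∀ i → Dec (P i)) →
           (∀ {i j} → P i → P j → i ≡ j) → ⟦ any? P? ⟧ ≡ ∑[ i < n ] ⟦ P? i ⟧
  ⟦⟧-any {n} {P} P? unique with any? P?
  ... | yes (i , pᵢ) = begin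
    1ℚ                    ≡⟨ ∑-unit-1 i ⟨
    ∑[ j < n ] unit i j   ≡⟨ ∑-cong {n} (λ j → ⟦⟧-cong (λ i≡j → subst P i≡j pᵢ) (unique pᵢ) (i ≟ j) (P? j)) ⟩
    ∑[ j < n ] ⟦ P? j ⟧   ∎
  ... | no ¬∃p = begin
    0ℚ                    ≡⟨ ∑-0 n ⟨
    ∑[ j < n ] 0ℚ         ≡⟨ ∑-cong {n} (λ j → ⟦⟧-cong (λ ()) (λ pⱼ → ¬∃p (j , pⱼ)) (no λ ()) (P? j)) ⟩
    ∑[ j < n ] ⟦ P? j ⟧   ∎

  -- Laplacians

  module _ {N} (G : SimpleGraph N) where
    open SimpleGraph G

    laplacian-entries : ∀ i j → laplacian G i j ≡ unit i j * degree G i - adjacency G i j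
    laplacian-entries i j with i ≟ j
    ... | yes _ = cong (_- adjacency G i j) (sym (ℚ.*-identityˡ (degree G i)))
    ... | no _  = cong (_- adjacency G i j) (sym (ℚ.*-zeroˡ (degree G i)))

    laplacian-sym : laplacian G ᵀ ≈ laplacian G
    laplacian-sym i j = begin
      laplacian G j i
        ≡⟨ laplacian-entries j i ⟩
      unit j i * degree G j - adjacency G j i
        ≡⟨ cong₂ _-_ (trans (unit-subst (degree G) j i) (cong (_* degree G i) (unit-sym j i)))
                     (⟦⟧-cong symm symm (adj? j i) (adj? i j)) ⟩
      unit i j * degree G i - adjacency G i j
        ≡⟨ laplacian-entries i j ⟨
      laplacian G i j ∎

    laplacian-rows : ∀ i → ∑[ k < N ] laplacian G i k ≡ 0ℚ
    laplacian-rows i = begin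
      ∑[ k < N ] laplacian G i k
        ≡⟨ ∑-cong (laplacian-entries i) ⟩
      ∑[ k < N ] (unit i k * degree G i - adjacency G i k)
        ≡⟨ ∑-- (λ k → unit i k * degree G i) (adjacency G i) ⟩
      ∑[ k < N ] (unit i k * degree G i) - degree G i
        ≡⟨ cong (_- degree G i) (∑-unit i (λ _ → degree G i)) ⟩
      degree G i - degree G i
        ≡⟨ ℚ.+-inverseʳ (degree G i) ⟩
      0ℚ ∎

  -- Rearranging sums

  ∑-split : ∀ k {l} (f : Vector (k ℕ.+ l)) →
            ∑[ u < k ℕ.+ l ] f u ≡ ∑[ i < k ] f (i ↑ˡ l) + ∑[ j < l ] f (k ↑ʳ j)
  ∑-split zero    f = sym (ℚ.+-identityˡ _)
  ∑-split (suc k) f = trans (cong (f zero +_) (∑-split k (λ u → f (suc u)))) (sym (ℚ.+-assoc (f zero) _ _))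

  ∑-combine : ∀ n {k} (f : Vector (n ℕ.* k)) →
              ∑[ u < n ℕ.* k ] f u ≡ ∑[ i < n ] ∑[ b < k ] f (combine i b)
  ∑-combine zero    f = refl
  ∑-combine (suc n) {k} f = trans (∑-split k f)
    (cong (∑[ b < k ] f (b ↑ˡ (n ℕ.* k)) +_) (∑-combine n (λ u → f (k ↑ʳ u))))

  ∑-punchIn : ∀ {k} (y : Fin (suc k)) (f : Vector (suc k)) →
              ∑[ b < k ] f (punchIn y b) ≡ ∑[ a < suc k ] f a - f y
  ∑-punchIn {k} y f = trans
    (solve 2 (λ p q → q := (p :+ q) :- p) refl (f y) (∑[ b < k ] f (punchIn y b)))
    (cong (_- f y) (sym (sum-remove {i = y} f)))

  ∑∑-comm : ∀ {N n m} (F : Fin N → Fin n → Fin m → ℚ) →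
    ∑[ v < N ] ∑[ i < n ] ∑[ a < m ] F v i a ≡ ∑[ i < n ] ∑[ a < m ] ∑[ v < N ] F v i a
  ∑∑-comm {N} {n} {m} F = trans (∑-comm (λ v i → ∑[ a < m ] F v i a)) (∑-cong {n} λ i → ∑-comm (λ v a → F v i a))

  ∑-unitʳ : ∀ {n} (f : Vector n) (i : Fin n) → ∑[ k < n ] (f k * unit k i) ≡ f i
  ∑-unitʳ f i = trans (∑-cong λ k → trans (ℚ.*-comm (f k) (unit k i)) (cong (_* f k) (unit-sym k i))) (∑-unit i f)

  -- Vertices and Laplacian of the flower

  module Flower {n-1 k : ℕ} (3≤n : 3 ℕ.≤ suc n-1) {x y : Fin (suc k)} (x≢y : x ≢ y) where

    n m V : ℕ
    n = suc n-1
    m = suc k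
    V = n ℕ.* k

    γ : Fin n → Fin m → Fin V
    γ = glue x≢y

    γ-≢ : ∀ i {a} (y≢a : y ≢ a) → γ i a ≡ combine i (punchOut y≢a)
    γ-≢ i {a} y≢a with y ≟ a
    ... | yes y≡a = contradiction y≡a y≢a
    ... | no _    = cong (combine i) (punchOut-cong y refl)

    γ-y : ∀ i → γ i y ≡ γ (next i) x
    γ-y i with y ≟ y
    ... | yes _  = sym (γ-≢ (next i) _)
    ... | no y≢y = contradiction refl y≢y

    γ-punchIn : ∀ i b → γ i (punchIn y b) ≡ combine i b
    γ-punchIn i b = trans (γ-≢ i (≢-sym (punchInᵢ≢i y b)))
      (cong (combine i) (trans (punchOut-cong y refl) (punchOut-punchIn y)))

    petal : Fin V → Fin n
    petal u = proj₁ (remQuot {n} k u)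

    place : Fin V → Fin m
    place u = punchIn y (proj₂ (remQuot {n} k u))

    γ-coordinates : ∀ u → γ (petal u) (place u) ≡ u
    γ-coordinates u = trans (γ-punchIn (petal u) _) (combine-remQuot {n} k u)

    -- The condition for a function on the disjoint petals to descend to the vertices of the flower.
    Glued : (Fin n → Fin m → ℚ) → Set
    Glued f = ∀ i → f i y ≡ f (next i) x

    glued-γ : ∀ {f} → Glued f → ∀ i a → f (petal (γ i a)) (place (γ i a)) ≡ f i a
    glued-γ {f} glued i a with y ≟ a
    ... | no y≢a = begin
      f′ (remQuot k (combine i (punchOut y≢a)))
        ≡⟨ cong f′ (remQuot-combine i (punchOut y≢a)) ⟩
      f i (punchIn y (punchOut y≢a))
        ≡⟨ cong (f i) (punchIn-punchOut y≢a) ⟩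
      f i a ∎
      where
      f′ : Fin n × Fin k → ℚ
      f′ (j , b) = f j (punchIn y b)
    ... | yes refl = begin
      f′ (remQuot k (combine (next i) (punchOut y≢x)))
        ≡⟨ cong f′ (remQuot-combine (next i) (punchOut y≢x)) ⟩
      f (next i) (punchIn y (punchOut y≢x))
        ≡⟨ cong (f (next i)) (punchIn-punchOut y≢x) ⟩
      f (next i) x
        ≡⟨ glued i ⟨
      f i y ∎
      where
      y≢x : y ≢ x
      y≢x y≡x = x≢y (sym y≡x)

      f′ : Fin n × Fin k → ℚ
      f′ (j , b) = f j (punchIn y b)

    -- Each hub has two names, y in one petal and x in the next; dropping the y of every petal
    -- counts each vertex once.
    ∑-vertices : ∀ {f} → Glued f →
      ∑[ u < V ] f (petal u) (place u) ≡ ∑[ i < n ] (∑[ a < m ] f i a - f i y)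
    ∑-vertices {f} glued = begin
      ∑[ u < V ] f̂ u
        ≡⟨ ∑-combine n f̂ ⟩
      ∑[ i < n ] ∑[ b < k ] f̂ (combine i b)
        ≡⟨ ∑-cong {n} (λ i → trans
             (∑-cong {k} λ b → trans (cong f̂ (sym (γ-punchIn i b))) (glued-γ glued i (punchIn y b)))
             (∑-punchIn y (f i))) ⟩
      ∑[ i < n ] (∑[ a < m ] f i a - f i y) ∎
      where
      f̂ : Vector V
      f̂ u = f (petal u) (place u)

    -- `glue` moves only the place `y` to another petal, so different petals can meet only if one of
    -- the two places is `y`.
    data Meeting (i : Fin n) (a : Fin m) (j : Fin n) (b : Fin m) : Set where
      same  : i ≡ j → Meeting i a j b
      ahead : a ≡ y → next i ≡ j → Meeting i a j b
      back  : b ≡ y → next j ≡ i → Meeting i a j b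

    meeting : ∀ {i a j b} → γ i a ≡ γ j b → Meeting i a j b
    meeting {i} {a} {j} {b} eq with y ≟ a | y ≟ b
    ... | yes _    | yes _    = same (next-injective (combine-injectiveˡ (next i) _ (next j) _ eq))
    ... | yes refl | no _     = ahead refl (combine-injectiveˡ (next i) _ j _ eq)
    ... | no _     | yes refl = back refl (sym (combine-injectiveˡ i _ (next j) _ eq))
    ... | no _     | no _     = same (combine-injectiveˡ i _ j _ eq)

    -- Two petals with two common vertices would be successors of each other,
    -- which needs n ≤ 2.
    edge-petal : ∀ {i a b j a′ b′} → a ≢ b → a′ ≢ b′ → γ i a ≡ γ j a′ → γ i b ≡ γ j b′ → i ≡ j
    edge-petal {i} a≢b a′≢b′ p q with meeting p | meeting q
    ... | same i≡j     | _            = i≡j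
    ... | ahead _ _    | same i≡j     = i≡j
    ... | back _ _     | same i≡j     = i≡j
    ... | ahead a≡y _  | ahead b≡y _  = contradiction (trans a≡y (sym b≡y)) a≢b
    ... | back a′≡y _  | back b′≡y _  = contradiction (trans a′≡y (sym b′≡y)) a′≢b′
    ... | ahead _ refl | back _ eq    = contradiction eq (next²≢ 3≤n i)
    ... | back _ eq    | ahead _ refl = contradiction eq (next²≢ 3≤n i)

    γ-injective : ∀ i {a b} → γ i a ≡ γ i b → a ≡ b
    γ-injective i = glue-injective (ℕ.≤-trans (s≤s (s≤s z≤n)) 3≤n) x≢y i

    F : SimpleGraph V
    F = completeFlower 3≤n x≢y

    N M : ℚ
    N = ι n
    M = ι m

    -- An edge determines its petal by `edge-petal` and its two places by `γ-injective`, so the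
    -- number of triples (i, a, b) realising it is 0 or 1. The subtracted term removes b = a.
    adjacency-flower : ∀ u v → adjacency F u v ≡
      ∑[ i < n ] ∑[ a < m ] (unit (γ i a) u * (∑[ b < m ] unit (γ i b) v - unit (γ i a) v))
    adjacency-flower u v = begin
      adjacency F u v
        ≡⟨ ⟦⟧-any (λ i → any? λ a → any? λ b → edge? i a b)
             (λ (_ , _ , a≢b , p , q) (_ , _ , a′≢b′ , p′ , q′) →
               edge-petal a≢b a′≢b′ (trans p (sym p′)) (trans q (sym q′))) ⟩
      ∑[ i < n ] ⟦ any? (λ a → any? λ b → edge? i a b) ⟧
        ≡⟨ ∑-cong {n} (λ i → trans
             (⟦⟧-any (λ a → any? λ b → edge? i a b)
               (λ (_ , _ , p , _) (_ , _ , p′ , _) → γ-injective i (trans p (sym p′))))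
             (∑-cong {m} λ a → ⟦⟧-any (edge? i a)
               (λ (_ , _ , q) (_ , _ , q′) → γ-injective i (trans q (sym q′))))) ⟩
      ∑[ i < n ] ∑[ a < m ] ∑[ b < m ] ⟦ edge? i a b ⟧
        ≡⟨ ∑-cong {n} (λ i → ∑-cong {m} λ a → petal-row i a) ⟩
      ∑[ i < n ] ∑[ a < m ] (unit (γ i a) u * (∑[ b < m ] unit (γ i b) v - unit (γ i a) v)) ∎
      where
      edge? : ∀ i a b → Dec (a ≢ b × γ i a ≡ u × γ i b ≡ v)
      edge? i a b = ¬? (a ≟ b) ×-dec (γ i a ≟ u) ×-dec (γ i b ≟ v)

      petal-row : ∀ i a → ∑[ b < m ] ⟦ edge? i a b ⟧ ≡ unit (γ i a) u * (∑[ b < m ] unit (γ i b) v - unit (γ i a) v)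
      petal-row i a = begin
        ∑[ b < m ] ⟦ edge? i a b ⟧
          ≡⟨ ∑-cong {m} (λ b → trans (⟦⟧-× (¬? (a ≟ b)) ((γ i a ≟ u) ×-dec (γ i b ≟ v)))
               (trans (cong₂ _*_ (⟦⟧-¬ (a ≟ b)) (⟦⟧-× (γ i a ≟ u) (γ i b ≟ v)))
                 (solve 3 (λ e p q → (con 1ℚ :- e) :* (p :* q) := p :* (q :- e :* q)) refl
                   (unit a b) (unit (γ i a) u) (unit (γ i b) v)))) ⟩
        ∑[ b < m ] (unit (γ i a) u * (unit (γ i b) v - unit a b * unit (γ i b) v))
          ≡⟨ ∑-*ˡ {m} (unit (γ i a) u) (λ b → unit (γ i b) v - unit a b * unit (γ i b) v) ⟩
        unit (γ i a) u * ∑[ b < m ] (unit (γ i b) v - unit a b * unit (γ i b) v)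
          ≡⟨ cong (unit (γ i a) u *_) (trans (∑-- {m} (λ b → unit (γ i b) v) (λ b → unit a b * unit (γ i b) v))
               (cong (λ z → ∑[ b < m ] unit (γ i b) v - z) (∑-unit a (λ b → unit (γ i b) v)))) ⟩
        unit (γ i a) u * (∑[ b < m ] unit (γ i b) v - unit (γ i a) v) ∎

    -- Every name (i, a) of `u` contributes m - 1, so hubs automatically receive 2(m - 1).
    degree-flower : ∀ u → degree F u ≡ ∑[ i < n ] ∑[ a < m ] (unit (γ i a) u * (M - 1ℚ))
    degree-flower u = begin
      ∑[ v < V ] adjacency F u v
        ≡⟨ ∑-cong {V} (adjacency-flower u) ⟩
      ∑[ v < V ] ∑[ i < n ] ∑[ a < m ] (unit (γ i a) u * (∑[ b < m ] unit (γ i b) v - unit (γ i a) v))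
        ≡⟨ ∑∑-comm (λ v i a → unit (γ i a) u * (∑[ b < m ] unit (γ i b) v - unit (γ i a) v)) ⟩
      ∑[ i < n ] ∑[ a < m ] ∑[ v < V ] (unit (γ i a) u * (∑[ b < m ] unit (γ i b) v - unit (γ i a) v))
        ≡⟨ ∑-cong {n} (λ i → ∑-cong {m} λ a → trans
             (∑-*ˡ {V} (unit (γ i a) u) (λ v → ∑[ b < m ] unit (γ i b) v - unit (γ i a) v))
             (cong (unit (γ i a) u *_) (trans
               (∑-- {V} (λ v → ∑[ b < m ] unit (γ i b) v) (unit (γ i a)))
               (cong₂ _-_ (trans (∑-comm {V} {m} (λ v b → unit (γ i b) v))
                            (trans (∑-cong {m} λ b → ∑-unit-1 (γ i b)) (trans (∑-const m 1ℚ) (ℚ.*-identityʳ M))))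
                          (∑-unit-1 (γ i a)))))) ⟩
      ∑[ i < n ] ∑[ a < m ] (unit (γ i a) u * (M - 1ℚ)) ∎

    -- The sum over all petals of the Laplacian mI - J of K_m, transported along `γ i`.
    laplacian-flower : ∀ u v → laplacian F u v ≡
      ∑[ i < n ] ∑[ a < m ] (unit (γ i a) u * (M * unit (γ i a) v - ∑[ b < m ] unit (γ i b) v))
    laplacian-flower u v = begin
      laplacian F u v
        ≡⟨ laplacian-entries F u v ⟩
      unit u v * degree F u - adjacency F u v
        ≡⟨ cong₂ (λ p q → unit u v * p - q) (degree-flower u) (adjacency-flower u v) ⟩
      unit u v * ∑[ i < n ] ∑[ a < m ] D i a - ∑[ i < n ] ∑[ a < m ] B i a
        ≡⟨ cong (_- ∑[ i < n ] ∑[ a < m ] B i a) (trans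
             (sym (∑-*ˡ (unit u v) (λ i → ∑[ a < m ] D i a)))
             (∑-cong {n} λ i → sym (∑-*ˡ (unit u v) (D i)))) ⟩
      ∑[ i < n ] ∑[ a < m ] (unit u v * D i a) - ∑[ i < n ] ∑[ a < m ] B i a
        ≡⟨ trans (∑-cong {n} (λ i → ∑-- (λ a → unit u v * D i a) (B i)))
             (∑-- (λ i → ∑[ a < m ] (unit u v * D i a)) (λ i → ∑[ a < m ] B i a)) ⟨
      ∑[ i < n ] ∑[ a < m ] (unit u v * D i a - B i a)
        ≡⟨ ∑-cong {n} (λ i → ∑-cong {m} λ a → entry i a) ⟩
      ∑[ i < n ] ∑[ a < m ] (unit (γ i a) u * (M * unit (γ i a) v - ∑[ b < m ] unit (γ i b) v)) ∎
      where
      D B : Fin n → Fin m → ℚ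
      D i a = unit (γ i a) u * (M - 1ℚ)
      B i a = unit (γ i a) u * (∑[ b < m ] unit (γ i b) v - unit (γ i a) v)

      entry : ∀ i a → unit u v * D i a - B i a ≡
                      unit (γ i a) u * (M * unit (γ i a) v - ∑[ b < m ] unit (γ i b) v)
      entry i a = begin
        unit u v * (p * (M - 1ℚ)) - p * (s - q)
          ≡⟨ solve 5 (λ e p q s m → e :* (p :* (m :- con 1ℚ)) :- p :* (s :- q) := (p :* e) :* (m :- con 1ℚ) :- p :* (s :- q)) refl (unit u v) p q s M ⟩
        p * unit u v * (M - 1ℚ) - p * (s - q)
          -- Where `p` is nonzero, `u` is `γ i a`, so `unit u v` may be replaced by `q`.
          ≡⟨ cong (λ z → z * (M - 1ℚ) - p * (s - q)) (sym (unit-subst (λ w → unit w v) (γ i a) u)) ⟩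
        p * q * (M - 1ℚ) - p * (s - q)
          ≡⟨ solve 4 (λ p q s m → p :* q :* (m :- con 1ℚ) :- p :* (s :- q) := p :* (m :* q :- s)) refl p q s M ⟩
        p * (M * q - s) ∎
        where
        p q s : ℚ
        p = unit (γ i a) u
        q = unit (γ i a) v
        s = ∑[ b < m ] unit (γ i b) v

    laplacian-flower-apply : ∀ (f : Vector V) u → ∑[ v < V ] (laplacian F u v * f v) ≡
      ∑[ i < n ] ∑[ a < m ] (unit (γ i a) u * (M * f (γ i a) - ∑[ b < m ] f (γ i b)))
    laplacian-flower-apply f u = begin
      ∑[ v < V ] (laplacian F u v * f v)
        ≡⟨ ∑-cong {V} (λ v → trans (cong (_* f v) (laplacian-flower u v))
             (trans (sym (∑-*ʳ (λ i → ∑[ a < m ] E v i a) (f v))) (∑-cong {n} λ i → sym (∑-*ʳ (E v i) (f v))))) ⟩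
      ∑[ v < V ] ∑[ i < n ] ∑[ a < m ] (E v i a * f v)
        ≡⟨ ∑∑-comm (λ v i a → E v i a * f v) ⟩
      ∑[ i < n ] ∑[ a < m ] ∑[ v < V ] (E v i a * f v)
        ≡⟨ ∑-cong {n} (λ i → ∑-cong {m} λ a → entry i a) ⟩
      ∑[ i < n ] ∑[ a < m ] (unit (γ i a) u * (M * f (γ i a) - ∑[ b < m ] f (γ i b))) ∎
      where
      E : Fin V → Fin n → Fin m → ℚ
      E v i a = unit (γ i a) u * (M * unit (γ i a) v - ∑[ b < m ] unit (γ i b) v)

      entry : ∀ i a → ∑[ v < V ] (E v i a * f v) ≡ unit (γ i a) u * (M * f (γ i a) - ∑[ b < m ] f (γ i b))
      entry i a = begin
        ∑[ v < V ] (E v i a * f v)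
          ≡⟨ ∑-cong {V} (λ v → trans
               (solve 5 (λ p m q s f → p :* (m :* q :- s) :* f := p :* (m :* (q :* f) :- s :* f)) refl
                 (unit (γ i a) u) M (unit (γ i a) v) (∑[ b < m ] unit (γ i b) v) (f v))
               (cong (λ z → unit (γ i a) u * (M * (unit (γ i a) v * f v) - z)) (sym (∑-*ʳ (λ b → unit (γ i b) v) (f v))))) ⟩
        ∑[ v < V ] (unit (γ i a) u * (M * (unit (γ i a) v * f v) - ∑[ b < m ] (unit (γ i b) v * f v)))
          ≡⟨ ∑-*ˡ {V} (unit (γ i a) u) (λ v → M * (unit (γ i a) v * f v) - ∑[ b < m ] (unit (γ i b) v * f v)) ⟩
        unit (γ i a) u * ∑[ v < V ] (M * (unit (γ i a) v * f v) - ∑[ b < m ] (unit (γ i b) v * f v))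
          ≡⟨ cong (unit (γ i a) u *_) (trans
               (∑-- {V} (λ v → M * (unit (γ i a) v * f v)) (λ v → ∑[ b < m ] (unit (γ i b) v * f v)))
               (cong₂ _-_
                 (trans (∑-*ˡ {V} M (λ v → unit (γ i a) v * f v)) (cong (M *_) (∑-unit (γ i a) f)))
                 (trans (∑-comm {V} {m} (λ v b → unit (γ i b) v * f v)) (∑-cong {m} λ b → ∑-unit (γ i b) f)))) ⟩
        unit (γ i a) u * (M * f (γ i a) - ∑[ b < m ] f (γ i b)) ∎

  -- Grounded Green function of the flower

  kirchhoff-polynomial : ℚ → ℚ → ℚ
  kirchhoff-polynomial M N =
    N * ((ι 5 + ι 12 * N + N * N) + (M * M) * (- 1ℚ + ι 6 * N + N * N) - M * (1ℚ + ι 18 * N + ι 2 * (N * N)))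

  module Potential {n-1 k : ℕ} (3≤n : 3 ℕ.≤ suc n-1) {x y : Fin (suc k)} (x≢y : x ≢ y)
    (r : ℚ) (r*m≡1 : r * ι (suc k) ≡ 1ℚ) (s : ℚ) (s*n≡1 : s * ι (suc n-1) ≡ 1ℚ) where

    open Flower 3≤n x≢y
    open Cycle {n-1} s s*n≡1

    -- Within a petal, a place a divides the segment from x to y in the ratio
    -- t a : 1 - t a; ν is the indicator of the places other than x and y.
    t ν : Vector m
    t a = ½ * (1ℚ + unit y a - unit x a)
    ν a = 1ℚ - unit x a - unit y a

    unit-xy : unit x y ≡ 0ℚ
    unit-xy = unit-≢ x≢y

    unit-yx : unit y x ≡ 0ℚ
    unit-yx = unit-≢ (≢-sym x≢y)

    t-x : t x ≡ 0ℚ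
    t-x = cong₂ (λ p q → ½ * (1ℚ + p - q)) unit-yx (unit-refl x)

    t-y : t y ≡ 1ℚ
    t-y = cong₂ (λ p q → ½ * (1ℚ + p - q)) (unit-refl y) unit-xy

    ν-x : ν x ≡ 0ℚ
    ν-x = cong₂ (λ p q → 1ℚ - p - q) (unit-refl x) unit-yx

    ν-y : ν y ≡ 0ℚ
    ν-y = cong₂ (λ p q → 1ℚ - p - q) unit-xy (unit-refl y)

    ∑-t : ∑[ a < m ] t a ≡ ½ * M
    ∑-t = begin
      ∑[ a < m ] (½ * (1ℚ + unit y a - unit x a))
        ≡⟨ ∑-*ˡ {m} ½ (λ a → 1ℚ + unit y a - unit x a) ⟩
      ½ * ∑[ a < m ] (1ℚ + unit y a - unit x a)
        ≡⟨ cong (½ *_) (trans (∑-- {m} (λ a → 1ℚ + unit y a) (unit x))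
             (cong₂ _-_ (trans (∑-+ {m} (λ _ → 1ℚ) (unit y)) (cong₂ _+_ (∑-const m 1ℚ) (∑-unit-1 y))) (∑-unit-1 x))) ⟩
      ½ * ((M * 1ℚ + 1ℚ) - 1ℚ)
        ≡⟨ solve 1 (λ m → con ½ :* ((m :* con 1ℚ :+ con 1ℚ) :- con 1ℚ) := con ½ :* m) refl M ⟩
      ½ * M ∎

    ∑-ν : ∑[ a < m ] ν a ≡ M - 1ℚ - 1ℚ
    ∑-ν = trans (∑-- {m} (λ a → 1ℚ - unit x a) (unit y)) (cong₂ _-_
      (trans (∑-- {m} (λ _ → 1ℚ) (unit x)) (cong₂ _-_ (trans (∑-const m 1ℚ) (ℚ.*-identityʳ M)) (∑-unit-1 x)))
      (∑-unit-1 y))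

    ∑-petal : ∀ c A B D E → ∑[ a < m ] (A + t a * B + ν a * unit a c * D + ν a * E) ≡
              M * A + ½ * M * B + ν c * D + (M - 1ℚ - 1ℚ) * E
    ∑-petal c A B D E = trans (∑-+ {m} (λ a → A + t a * B + ν a * unit a c * D) (λ a → ν a * E)) (cong₂ _+_
      (trans (∑-+ {m} (λ a → A + t a * B) (λ a → ν a * unit a c * D)) (cong₂ _+_
        (trans (∑-+ {m} (λ a → A) (λ a → t a * B)) (cong₂ _+_ (∑-const m A)
          (trans (∑-*ʳ t B) (cong (_* B) ∑-t))))
        (trans (∑-*ʳ (λ a → ν a * unit a c) D) (cong (_* D) (∑-unitʳ ν c)))))
      (trans (∑-*ʳ ν E) (cong (_* E) ∑-ν)))

    -- Potential at hub `i` of the cycle with unit resistances, when the unit current of place `c`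
    -- in petal `j` is shared between the ends of that petal in the proportion 1 - t c : t c.
    P : Fin n → Fin m → Fin n → ℚ
    P j c i = (1ℚ - t c) * C i j + t c * C i (next j)

    -- The potential at place a of petal i of a unit current entering at place c
    -- of petal j and leaving at hub 0: a star-mesh reduction of each petal leaves
    -- a cycle of n edges of resistance 2/m.
    g : Fin n → Fin m → Fin n → Fin m → ℚ
    g i a j c = (r + r) * ((1ℚ - t a) * P j c i + t a * P j c (next i))
              + r * (unit i j * (ν a * unit a c)) + ½ * r * (unit i j * (ν a * ν c))

    g-sym : ∀ i a j c → g i a j c ≡ g j c i a
    g-sym i a j c = cong₂ _+_ (cong₂ _+_ (cong ((r + r) *_) ext) (cong (r *_) (cong₂ _*_ (unit-sym i j) diagonal)))
      (cong (½ * r *_) (cong₂ _*_ (unit-sym i j) (ℚ.*-comm (ν a) (ν c))))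
      where
      ext : (1ℚ - t a) * P j c i + t a * P j c (next i) ≡ (1ℚ - t c) * P i a j + t c * P i a (next j)
      ext = begin
        (1ℚ - t a) * P j c i + t a * P j c (next i)
          ≡⟨ cong₂ (λ p q → (1ℚ - t a) * p + t a * q)
               (cong₂ (λ p q → (1ℚ - t c) * p + t c * q) (C-sym i j) (C-sym i (next j)))
               (cong₂ (λ p q → (1ℚ - t c) * p + t c * q) (C-sym (next i) j) (C-sym (next i) (next j))) ⟩
        (1ℚ - t a) * ((1ℚ - t c) * C j i + t c * C (next j) i)
          + t a * ((1ℚ - t c) * C j (next i) + t c * C (next j) (next i))
          ≡⟨ solve 6 (λ a c p q u v →
               (con 1ℚ :- a) :* ((con 1ℚ :- c) :* p :+ c :* q) :+ a :* ((con 1ℚ :- c) :* u :+ c :* v)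
               := (con 1ℚ :- c) :* ((con 1ℚ :- a) :* p :+ a :* u) :+ c :* ((con 1ℚ :- a) :* q :+ a :* v)) refl
               (t a) (t c) (C j i) (C (next j) i) (C j (next i)) (C (next j) (next i)) ⟩
        (1ℚ - t c) * P i a j + t c * P i a (next j) ∎

      diagonal : ν a * unit a c ≡ ν c * unit c a
      diagonal = begin
        ν a * unit a c  ≡⟨ ℚ.*-comm (ν a) (unit a c) ⟩
        unit a c * ν a  ≡⟨ unit-subst ν a c ⟩
        unit a c * ν c  ≡⟨ ℚ.*-comm (unit a c) (ν c) ⟩
        ν c * unit a c  ≡⟨ cong (ν c *_) (unit-sym a c) ⟩
        ν c * unit c a  ∎

    g-hub : ∀ i {a} j c → ν a ≡ 0ℚ → g i a j c ≡ (r + r) * ((1ℚ - t a) * P j c i + t a * P j c (next i))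
    g-hub i {a} j c ν≡0 = trans
      (cong (λ z → A + r * (unit i j * (z * unit a c)) + ½ * r * (unit i j * (z * ν c))) ν≡0)
      (solve 5 (λ A r u v w → A :+ r :* (u :* (con 0ℚ :* v)) :+ con ½ :* r :* (u :* (con 0ℚ :* w)) := A) refl
        A r (unit i j) (unit a c) (ν c))
      where
      A : ℚ
      A = (r + r) * ((1ℚ - t a) * P j c i + t a * P j c (next i))

    g-x : ∀ i j c → g i x j c ≡ (r + r) * P j c i
    g-x i j c = trans (g-hub i j c ν-x) (trans (cong (λ z → (r + r) * ((1ℚ - z) * P j c i + z * P j c (next i))) t-x)
      (solve 3 (λ r p q → r :* ((con 1ℚ :- con 0ℚ) :* p :+ con 0ℚ :* q) := r :* p) refl (r + r) (P j c i) (P j c (next i))))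

    g-y : ∀ i j c → g i y j c ≡ (r + r) * P j c (next i)
    g-y i j c = trans (g-hub i j c ν-y) (trans (cong (λ z → (r + r) * ((1ℚ - z) * P j c i + z * P j c (next i))) t-y)
      (solve 3 (λ r p q → r :* ((con 1ℚ :- con 1ℚ) :* p :+ con 1ℚ :* q) := r :* q) refl (r + r) (P j c i) (P j c (next i))))

    g-glued : ∀ j c → Glued (λ i a → g i a j c)
    g-glued j c i = trans (g-y i j c) (sym (g-x (next i) j c))

    ∑-g : ∀ i j c → ∑[ a < m ] g i a j c ≡
          (r + r) * (½ * M * (P j c i + P j c (next i))) + ½ * (r * M) * (unit i j * ν c)
    ∑-g i j c = begin
      ∑[ a < m ] g i a j c
        ≡⟨ ∑-cong {m} (λ a → solve 8 (λ r t p q u v w z →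
               (r :+ r) :* ((con 1ℚ :- t) :* p :+ t :* q) :+ r :* (u :* (v :* w)) :+ con ½ :* r :* (u :* (v :* z))
               := (r :+ r) :* p :+ t :* ((r :+ r) :* (q :- p)) :+ v :* w :* (r :* u) :+ v :* (con ½ :* r :* (u :* z))) refl
             r (t a) (P j c i) (P j c (next i)) (unit i j) (ν a) (unit a c) (ν c)) ⟩
      ∑[ a < m ] ((r + r) * P j c i + t a * ((r + r) * (P j c (next i) - P j c i))
                  + ν a * unit a c * (r * unit i j) + ν a * (½ * r * (unit i j * ν c)))
        ≡⟨ ∑-petal c _ _ _ _ ⟩
      M * ((r + r) * P j c i) + ½ * M * ((r + r) * (P j c (next i) - P j c i))
        + ν c * (r * unit i j) + (M - 1ℚ - 1ℚ) * (½ * r * (unit i j * ν c))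
        -- The source contributes r once and the m - 2 inner places r/2 each, together rm/2.
        ≡⟨ solve 6 (λ r m p q u z →
               m :* ((r :+ r) :* p) :+ con ½ :* m :* ((r :+ r) :* (q :- p)) :+ z :* (r :* u) :+ (m :- con 1ℚ :- con 1ℚ) :* (con ½ :* r :* (u :* z))
               := (r :+ r) :* (con ½ :* m :* (p :+ q)) :+ con ½ :* (r :* m) :* (u :* z)) refl
             r M (P j c i) (P j c (next i)) (unit i j) (ν c) ⟩
      (r + r) * (½ * M * (P j c i + P j c (next i))) + ½ * (r * M) * (unit i j * ν c) ∎

    -- The left side is the current fed into petal `i` at place `a`. The first term on the right is
    -- the current running through from x to y. The second occurs only in the petal of an inner
    -- source: a unit enters at `c` and half of it leaves at each of x and y.
    petal-current : ∀ i a j c → M * g i a j c - ∑[ b < m ] g i b j c ≡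
      (P j c i - P j c (next i)) * (unit x a - unit y a)
        + unit i j * (ν a * unit a c - ½ * ν c * (unit x a + unit y a))
    petal-current i a j c = begin
      M * g i a j c - ∑[ b < m ] g i b j c
        ≡⟨ cong (λ z → M * g i a j c - z) (∑-g i j c) ⟩
      M * g i a j c - ((r + r) * (½ * M * (P j c i + P j c (next i))) + ½ * (r * M) * (unit i j * ν c))
        ≡⟨ solve 9 (λ r m X Y p q u w z →
             m :* ((r :+ r) :* ((con 1ℚ :- con ½ :* (con 1ℚ :+ Y :- X)) :* p :+ con ½ :* (con 1ℚ :+ Y :- X) :* q)
                   :+ r :* (u :* ((con 1ℚ :- X :- Y) :* w)) :+ con ½ :* r :* (u :* ((con 1ℚ :- X :- Y) :* z)))
               :- ((r :+ r) :* (con ½ :* m :* (p :+ q)) :+ con ½ :* (r :* m) :* (u :* z))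
             := r :* m :* ((p :- q) :* (X :- Y) :+ u :* ((con 1ℚ :- X :- Y) :* w :- con ½ :* z :* (X :+ Y)))) refl
             r M (unit x a) (unit y a) (P j c i) (P j c (next i)) (unit i j) (unit a c) (ν c) ⟩
      r * M * rhs
        ≡⟨ trans (cong (_* rhs) r*m≡1) (ℚ.*-identityˡ rhs) ⟩
      rhs ∎
      where
      rhs : ℚ
      rhs = (P j c i - P j c (next i)) * (unit x a - unit y a)
        + unit i j * (ν a * unit a c - ½ * ν c * (unit x a + unit y a))

    module _ (u : Fin V) where

      -- Restriction of the indicator of `u` to the hubs, which becomes the test function in
      -- `green-identity`.
      hub : Vector n
      hub i = unit (γ i x) u

      petal-flow : ∀ i j c → ∑[ a < m ] (unit (γ i a) u * (M * g i a j c - ∑[ b < m ] g i b j c)) ≡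
        (P j c i - P j c (next i)) * (hub i - hub (next i))
          + unit i j * (ν c * unit (γ i c) u - ½ * ν c * (hub i + hub (next i)))
      petal-flow i j c = begin
        ∑[ a < m ] (unit (γ i a) u * (M * g i a j c - ∑[ b < m ] g i b j c))
          ≡⟨ ∑-cong {m} (λ a → trans (cong (unit (γ i a) u *_) (petal-current i a j c))
               (solve 8 (λ U d X Y e N w z → U :* (d :* (X :- Y) :+ e :* (N :* w :- con ½ :* z :* (X :+ Y)))
                 := X :* U :* (d :- e :* (con ½ :* z)) :- Y :* U :* (d :+ e :* (con ½ :* z)) :+ (N :* U) :* w :* e) refl
                 (unit (γ i a) u) d (unit x a) (unit y a) (unit i j) (ν a) (unit a c) (ν c))) ⟩
        ∑[ a < m ] (unit x a * unit (γ i a) u * A - unit y a * unit (γ i a) u * B + ν a * unit (γ i a) u * unit a c * unit i j)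
          ≡⟨ trans (∑-+ {m} (λ a → unit x a * unit (γ i a) u * A - unit y a * unit (γ i a) u * B) (λ a → ν a * unit (γ i a) u * unit a c * unit i j))
               (cong₂ _+_
                 (trans (∑-- {m} (λ a → unit x a * unit (γ i a) u * A) (λ a → unit y a * unit (γ i a) u * B)) (cong₂ _-_
                   (trans (∑-*ʳ {m} (λ a → unit x a * unit (γ i a) u) A) (cong (_* A) (∑-unit x (λ a → unit (γ i a) u))))
                   (trans (∑-*ʳ {m} (λ a → unit y a * unit (γ i a) u) B) (cong (_* B)
                     (trans (∑-unit y (λ a → unit (γ i a) u)) (cong (λ v → unit v u) (γ-y i)))))))
                 (trans (∑-*ʳ {m} (λ a → ν a * unit (γ i a) u * unit a c) (unit i j))
                   (cong (_* unit i j) (∑-unitʳ (λ a → ν a * unit (γ i a) u) c)))) ⟩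
        hub i * A - hub (next i) * B + ν c * unit (γ i c) u * unit i j
          ≡⟨ solve 6 (λ h h′ d e z U → h :* (d :- e :* (con ½ :* z)) :- h′ :* (d :+ e :* (con ½ :* z)) :+ z :* U :* e
               := d :* (h :- h′) :+ e :* (z :* U :- con ½ :* z :* (h :+ h′))) refl
               (hub i) (hub (next i)) d (unit i j) (ν c) (unit (γ i c) u) ⟩
        d * (hub i - hub (next i)) + unit i j * (ν c * unit (γ i c) u - ½ * ν c * (hub i + hub (next i))) ∎
        where
        d A B : ℚ
        d = P j c i - P j c (next i)
        A = d - unit i j * (½ * ν c)
        B = d + unit i j * (½ * ν c)

      flow-along-cycle : ∀ j c → ∑[ i < n ] ((P j c i - P j c (next i)) * (hub i - hub (next i))) ≡
        (1ℚ - t c) * (hub j - hub zero) + t c * (hub (next j) - hub zero)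
      flow-along-cycle j c = begin
        ∑[ i < n ] ((P j c i - P j c (next i)) * (hub i - hub (next i)))
          ≡⟨ ∑-cong {n} (λ i → solve 6 (λ t p q p′ q′ h →
                 (((con 1ℚ :- t) :* p :+ t :* q) :- ((con 1ℚ :- t) :* p′ :+ t :* q′)) :* h
                 := (con 1ℚ :- t) :* ((p :- p′) :* h) :+ t :* ((q :- q′) :* h)) refl
               (t c) (C i j) (C i (next j)) (C (next i) j) (C (next i) (next j)) (hub i - hub (next i))) ⟩
        ∑[ i < n ] ((1ℚ - t c) * D j i + t c * D (next j) i)
          ≡⟨ trans (∑-+ {n} (λ i → (1ℚ - t c) * D j i) (λ i → t c * D (next j) i)) (cong₂ _+_
               (trans (∑-*ˡ {n} (1ℚ - t c) (D j)) (cong ((1ℚ - t c) *_) (green-identity hub j)))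
               (trans (∑-*ˡ {n} (t c) (D (next j))) (cong (t c *_) (green-identity hub (next j))))) ⟩
        (1ℚ - t c) * (hub j - hub zero) + t c * (hub (next j) - hub zero) ∎
        where
        D : Fin n → Fin n → ℚ
        D j i = (C i j - C (next i) j) * (hub i - hub (next i))

      -- For an inner source, the halves leaving its petal at the two ends cancel the halves
      -- injected there into the cycle, which leaves the unit at `c` and the sink at hub 0. For a
      -- source at x or y the cycle term alone gives the result. The indicators of x and y treat all
      -- cases in one polynomial identity.
      net-flow : ∀ j c →
        ∑[ i < n ] ∑[ a < m ] (unit (γ i a) u * (M * g i a j c - ∑[ b < m ] g i b j c)) ≡ unit (γ j c) u - hub zero
      net-flow j c = begin
        ∑[ i < n ] ∑[ a < m ] (unit (γ i a) u * (M * g i a j c - ∑[ b < m ] g i b j c))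
          ≡⟨ ∑-cong {n} (λ i → petal-flow i j c) ⟩
        ∑[ i < n ] ((P j c i - P j c (next i)) * (hub i - hub (next i)) + unit i j * W i)
          ≡⟨ trans (∑-+ {n} (λ i → (P j c i - P j c (next i)) * (hub i - hub (next i))) (λ i → unit i j * W i)) (cong₂ _+_
               (flow-along-cycle j c)
               (trans (∑-cong {n} λ i → cong (_* W i) (unit-sym i j)) (∑-unit j W))) ⟩
        ((1ℚ - t c) * (hub j - hub zero) + t c * (hub (next j) - hub zero))
          + (ν c * U - ½ * ν c * (hub j + hub (next j)))
          ≡⟨ solve 6 (λ X Y h h′ h₀ U →
               ((con 1ℚ :- con ½ :* (con 1ℚ :+ Y :- X)) :* (h :- h₀) :+ con ½ :* (con 1ℚ :+ Y :- X) :* (h′ :- h₀))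
                 :+ ((con 1ℚ :- X :- Y) :* U :- con ½ :* (con 1ℚ :- X :- Y) :* (h :+ h′))
               := (X :* h :+ Y :* h′ :+ (con 1ℚ :- X :- Y) :* U) :- h₀) refl
               (unit x c) (unit y c) (hub j) (hub (next j)) (hub zero) U ⟩
        (unit x c * hub j + unit y c * hub (next j) + ν c * U) - hub zero
          ≡⟨ cong (_- hub zero) (cong (_+ ν c * U) (cong₂ _+_
               (unit-subst (λ a → unit (γ j a) u) x c)
               (trans (cong (λ v → unit y c * unit v u) (sym (γ-y j))) (unit-subst (λ a → unit (γ j a) u) y c)))) ⟩
        (unit x c * U + unit y c * U + ν c * U) - hub zero
          ≡⟨ solve 4 (λ X Y U h → (X :* U :+ Y :* U :+ (con 1ℚ :- X :- Y) :* U) :- h := U :- h) refl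
               (unit x c) (unit y c) U (hub zero) ⟩
        U - hub zero ∎
        where
        U : ℚ
        U = unit (γ j c) u

        W : Vector n
        W i = ν c * unit (γ i c) u - ½ * ν c * (hub i + hub (next i))

    G : Matrix V
    G u v = g (petal u) (place u) (petal v) (place v)

    G-sym : G ᵀ ≈ G
    G-sym u v = g-sym (petal v) (place v) (petal u) (place u)

    LG≡ : ∀ u v → (laplacian F ⊗ G) u v ≡ unit u v - hub u zero
    LG≡ u v = begin
      ∑[ w < V ] (laplacian F u w * G w v)
        ≡⟨ laplacian-flower-apply (λ w → G w v) u ⟩
      ∑[ i < n ] ∑[ a < m ] (unit (γ i a) u * (M * G (γ i a) v - ∑[ b < m ] G (γ i b) v))
        ≡⟨ ∑-cong {n} (λ i → ∑-cong {m} λ a → cong (unit (γ i a) u *_)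
             (cong₂ _-_ (cong (M *_) (G-γ i a)) (∑-cong {m} λ b → G-γ i b))) ⟩
      ∑[ i < n ] ∑[ a < m ] (unit (γ i a) u * (M * g i a j c - ∑[ b < m ] g i b j c))
        ≡⟨ net-flow u j c ⟩
      unit (γ j c) u - hub u zero
        ≡⟨ cong (_- hub u zero) (trans (cong (λ w → unit w u) (γ-coordinates v)) (unit-sym v u)) ⟩
      unit u v - hub u zero ∎
      where
      j : Fin n
      j = petal v

      c : Fin m
      c = place v

      G-γ : ∀ i a → G (γ i a) v ≡ g i a j c
      G-γ = glued-γ {λ i a → g i a j c} (g-glued j c)

    -- Trace and total sum of the potential

    -- Evaluates the petal sums of `∑-vertices` for functions constant on the m - 2 inner places.
    ∑-by-place : ∀ (φ : Vector m) c → (∀ a → x ≢ a → y ≢ a → φ a ≡ c) →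
                 ∑[ a < m ] φ a - φ y ≡ φ x + (M - 1ℚ - 1ℚ) * c
    ∑-by-place φ c φ≡c = begin
      ∑[ a < m ] φ a - φ y
        ≡⟨ cong (_- φ y) (∑-cong {m} split) ⟩
      ∑[ a < m ] (unit x a * φ a + unit y a * φ a + ν a * c) - φ y
        ≡⟨ cong (_- φ y) (trans (∑-+ {m} (λ a → unit x a * φ a + unit y a * φ a) (λ a → ν a * c)) (cong₂ _+_
             (trans (∑-+ {m} (λ a → unit x a * φ a) (λ a → unit y a * φ a)) (cong₂ _+_ (∑-unit x φ) (∑-unit y φ)))
             (trans (∑-*ʳ ν c) (cong (_* c) ∑-ν)))) ⟩
      φ x + φ y + (M - 1ℚ - 1ℚ) * c - φ y
        ≡⟨ solve 3 (λ p q r → p :+ q :+ r :- q := p :+ r) refl (φ x) (φ y) ((M - 1ℚ - 1ℚ) * c) ⟩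
      φ x + (M - 1ℚ - 1ℚ) * c ∎
      where
      split : ∀ a → φ a ≡ unit x a * φ a + unit y a * φ a + (1ℚ - unit x a - unit y a) * c
      split a with x ≟ a | y ≟ a
      ... | yes refl | yes refl = contradiction refl x≢y
      ... | yes _    | no _     = solve 2 (λ p c → p := con 1ℚ :* p :+ con 0ℚ :* p :+ (con 1ℚ :- con 1ℚ :- con 0ℚ) :* c) refl (φ a) c
      ... | no _     | yes _    = solve 2 (λ p c → p := con 0ℚ :* p :+ con 1ℚ :* p :+ (con 1ℚ :- con 0ℚ :- con 1ℚ) :* c) refl (φ a) c
      ... | no x≢a   | no y≢a   = trans (φ≡c a x≢a y≢a)
        (solve 2 (λ p c → c := con 0ℚ :* p :+ con 0ℚ :* p :+ (con 1ℚ :- con 0ℚ :- con 0ℚ) :* c) refl (φ a) c)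

    τ κ : ℚ
    τ = ∑[ i < n ] C i i
    κ = ∑[ i < n ] ∑[ j < n ] C i j

    g-diagonal-x : ∀ i → g i x i x ≡ (r + r) * C i i
    g-diagonal-x i = trans (g-x i i x) (cong ((r + r) *_) (trans (cong (λ z → (1ℚ - z) * C i i + z * C i (next i)) t-x)
      (solve 2 (λ p q → (con 1ℚ :- con 0ℚ) :* p :+ con 0ℚ :* q := p) refl (C i i) (C i (next i)))))

    -- At an inner place `t` is ½ and `ν` is 1. Interpolating in both arguments averages `C` over
    -- the four pairs of end hubs, and the local terms add r + r/2.
    g-diagonal : ∀ i a → x ≢ a → y ≢ a → g i a i a ≡
      (r + r) * (½ * ½ * (C i i + (C (next i) i + C (next i) i) + C (next i) (next i))) + (1ℚ + ½) * r
    g-diagonal i a x≢a y≢a = begin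
      g i a i a
        ≡⟨ cong₂ (λ T ν′ → (r + r) * ((1ℚ - T) * ((1ℚ - T) * C i i + T * C i (next i)) + T * ((1ℚ - T) * C (next i) i + T * C (next i) (next i)))
             + r * (unit i i * (ν′ * unit a a)) + ½ * r * (unit i i * (ν′ * ν′)))
             (cong₂ (λ p q → ½ * (1ℚ + p - q)) (unit-≢ y≢a) (unit-≢ x≢a))
             (cong₂ (λ p q → 1ℚ - p - q) (unit-≢ x≢a) (unit-≢ y≢a)) ⟩
      (r + r) * ((1ℚ - ½) * ((1ℚ - ½) * C i i + ½ * C i (next i)) + ½ * ((1ℚ - ½) * C (next i) i + ½ * C (next i) (next i)))
        + r * (unit i i * (1ℚ * unit a a)) + ½ * r * (unit i i * (1ℚ * 1ℚ))
        ≡⟨ cong₂ (λ p q → (r + r) * ((1ℚ - ½) * ((1ℚ - ½) * C i i + ½ * p) + ½ * ((1ℚ - ½) * C (next i) i + ½ * C (next i) (next i)))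
             + r * (q * (1ℚ * unit a a)) + ½ * r * (q * (1ℚ * 1ℚ))) (C-sym i (next i)) (unit-refl i) ⟩
      (r + r) * ((1ℚ - ½) * ((1ℚ - ½) * C i i + ½ * C (next i) i) + ½ * ((1ℚ - ½) * C (next i) i + ½ * C (next i) (next i)))
        + r * (1ℚ * (1ℚ * unit a a)) + ½ * r * (1ℚ * (1ℚ * 1ℚ))
        ≡⟨ cong (λ z → (r + r) * ((1ℚ - ½) * ((1ℚ - ½) * C i i + ½ * C (next i) i) + ½ * ((1ℚ - ½) * C (next i) i + ½ * C (next i) (next i)))
        + r * (1ℚ * (1ℚ * z)) + ½ * r * (1ℚ * (1ℚ * 1ℚ))) (unit-refl a) ⟩
      (r + r) * ((1ℚ - ½) * ((1ℚ - ½) * C i i + ½ * C (next i) i) + ½ * ((1ℚ - ½) * C (next i) i + ½ * C (next i) (next i)))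
        + r * (1ℚ * (1ℚ * 1ℚ)) + ½ * r * (1ℚ * (1ℚ * 1ℚ))
        ≡⟨ solve 4 (λ r p q s →
             (r :+ r) :* ((con 1ℚ :- con ½) :* ((con 1ℚ :- con ½) :* p :+ con ½ :* q) :+ con ½ :* ((con 1ℚ :- con ½) :* q :+ con ½ :* s))
               :+ r :* (con 1ℚ :* (con 1ℚ :* con 1ℚ)) :+ con ½ :* r :* (con 1ℚ :* (con 1ℚ :* con 1ℚ))
             := (r :+ r) :* (con ½ :* con ½ :* (p :+ (q :+ q) :+ s)) :+ (con 1ℚ :+ con ½) :* r) refl
             r (C i i) (C (next i) i) (C (next i) (next i)) ⟩
      (r + r) * (½ * ½ * (C i i + (C (next i) i + C (next i) i) + C (next i) (next i))) + (1ℚ + ½) * r ∎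

    trace-G : ∑[ u < V ] G u u ≡
      (r + r) * τ + (M - 1ℚ - 1ℚ) * ((r + r) * (τ - ½ * ½ * (N - 1ℚ)) + N * ((1ℚ + ½) * r))
    trace-G = begin
      ∑[ u < V ] G u u
        -- The diagonal is glued because `g` is glued in each argument separately, the second one by
        -- symmetry.
        ≡⟨ ∑-vertices {λ i a → g i a i a} (λ i →
             trans (g-glued i y i) (trans (g-sym (next i) x i y) (g-glued (next i) x i))) ⟩
      ∑[ i < n ] (∑[ a < m ] g i a i a - g i y i y)
        ≡⟨ ∑-cong {n} (λ i → trans (∑-by-place (λ a → g i a i a) _ (g-diagonal i))
             (cong (_+ (M - 1ℚ - 1ℚ) * (ρ * S i + (1ℚ + ½) * r)) (g-diagonal-x i))) ⟩
      ∑[ i < n ] ((r + r) * C i i + (M - 1ℚ - 1ℚ) * (ρ * S i + (1ℚ + ½) * r))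
        ≡⟨ trans (∑-+ {n} (λ i → (r + r) * C i i) (λ i → (M - 1ℚ - 1ℚ) * (ρ * S i + (1ℚ + ½) * r))) (cong₂ _+_
             (∑-*ˡ {n} (r + r) (λ i → C i i))
             (trans (∑-*ˡ {n} (M - 1ℚ - 1ℚ) (λ i → ρ * S i + (1ℚ + ½) * r)) (cong ((M - 1ℚ - 1ℚ) *_)
               (trans (∑-+ {n} (λ i → ρ * S i) (λ _ → (1ℚ + ½) * r)) (cong₂ _+_
                 (trans (∑-*ˡ {n} ρ S) (cong (ρ *_) ∑-S))
                 (∑-const n ((1ℚ + ½) * r))))))) ⟩
      (r + r) * τ + (M - 1ℚ - 1ℚ) * (ρ * (½ * ½ * (τ + (τ - ½ * (N - 1ℚ) + (τ - ½ * (N - 1ℚ))) + τ)) + N * ((1ℚ + ½) * r))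
        ≡⟨ cong (λ z → (r + r) * τ + (M - 1ℚ - 1ℚ) * (ρ * z + N * ((1ℚ + ½) * r)))
             (solve 2 (λ t n → con ½ :* con ½ :* (t :+ (t :- con ½ :* (n :- con 1ℚ) :+ (t :- con ½ :* (n :- con 1ℚ))) :+ t)
               := t :- con ½ :* con ½ :* (n :- con 1ℚ)) refl τ N) ⟩
      (r + r) * τ + (M - 1ℚ - 1ℚ) * ((r + r) * (τ - ½ * ½ * (N - 1ℚ)) + N * ((1ℚ + ½) * r)) ∎
      where
      ρ : ℚ
      ρ = r + r

      S : Vector n
      S i = ½ * ½ * (C i i + (C (next i) i + C (next i) i) + C (next i) (next i))

      ∑-S : ∑[ i < n ] S i ≡ ½ * ½ * (τ + (τ - ½ * (N - 1ℚ) + (τ - ½ * (N - 1ℚ))) + τ)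
      ∑-S = trans (∑-*ˡ {n} (½ * ½) (λ i → C i i + (C (next i) i + C (next i) i) + C (next i) (next i)))
        (cong (½ * ½ *_) (trans (∑-+ {n} (λ i → C i i + (C (next i) i + C (next i) i)) (λ i → C (next i) (next i))) (cong₂ _+_
          (trans (∑-+ {n} (λ i → C i i) (λ i → C (next i) i + C (next i) i)) (cong (τ +_)
            (trans (∑-+ {n} (λ i → C (next i) i) (λ i → C (next i) i)) (cong₂ _+_ C-trace-next C-trace-next))))
          (∑-next (λ i → C i i)))))

    column-G : ∀ j c → ∑[ i < n ] (∑[ a < m ] g i a j c - g i y j c) ≡
      (r + r) * ((M - 1ℚ) * ∑[ i < n ] P j c i) + ½ * (r * M) * ν c
    column-G j c = begin
      ∑[ i < n ] (∑[ a < m ] g i a j c - g i y j c)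
        ≡⟨ ∑-cong {n} (λ i → trans (cong₂ _-_ (∑-g i j c) (g-y i j c))
             (solve 6 (λ r m p q u z →
               ((r :+ r) :* (con ½ :* m :* (p :+ q)) :+ con ½ :* (r :* m) :* (u :* z)) :- (r :+ r) :* q
               := (r :+ r) :* (con ½ :* m) :* p :+ (r :+ r) :* (con ½ :* m :- con 1ℚ) :* q :+ con ½ :* (r :* m) :* z :* u) refl
               r M (P j c i) (P j c (next i)) (unit i j) (ν c))) ⟩
      ∑[ i < n ] (A * P j c i + B * P j c (next i) + D * unit i j)
        ≡⟨ trans (∑-+ {n} (λ i → A * P j c i + B * P j c (next i)) (λ i → D * unit i j)) (cong₂ _+_
             (trans (∑-+ {n} (λ i → A * P j c i) (λ i → B * P j c (next i))) (cong₂ _+_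
               (∑-*ˡ {n} A (P j c))
               (trans (∑-*ˡ {n} B (λ i → P j c (next i))) (cong (B *_) (∑-next (P j c))))))
             (trans (∑-*ˡ {n} D (λ i → unit i j)) (cong (D *_)
               (trans (∑-cong {n} λ i → unit-sym i j) (∑-unit-1 j))))) ⟩
      A * Π + B * Π + D * 1ℚ
        ≡⟨ solve 4 (λ r m p z →
             (r :+ r) :* (con ½ :* m) :* p :+ (r :+ r) :* (con ½ :* m :- con 1ℚ) :* p :+ con ½ :* (r :* m) :* z :* con 1ℚ
             := (r :+ r) :* ((m :- con 1ℚ) :* p) :+ con ½ :* (r :* m) :* z) refl r M Π (ν c) ⟩
      (r + r) * ((M - 1ℚ) * Π) + ½ * (r * M) * ν c ∎
      where
      A B D Π : ℚ
      A = (r + r) * (½ * M)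
      B = (r + r) * (½ * M - 1ℚ)
      D = ½ * (r * M) * ν c
      Π = ∑[ i < n ] P j c i

    C-column : Vector n
    C-column j = ∑[ i < n ] C i j

    ∑-P : ∀ j c → ∑[ i < n ] P j c i ≡ (1ℚ - t c) * C-column j + t c * C-column (next j)
    ∑-P j c = trans (∑-+ {n} (λ i → (1ℚ - t c) * C i j) (λ i → t c * C i (next j)))
      (cong₂ _+_ (∑-*ˡ {n} (1ℚ - t c) (λ i → C i j)) (∑-*ˡ {n} (t c) (λ i → C i (next j))))

    -- The column sum of `G` at (j, c), expressed on all places including y so that it is glued and
    -- `∑-vertices` applies a second time.
    σ : Fin n → Fin m → ℚ
    σ j c = (r + r) * ((M - 1ℚ) * ((1ℚ - t c) * C-column j + t c * C-column (next j))) + ½ * (r * M) * ν c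

    σ-y : ∀ j → σ j y ≡ (r + r) * ((M - 1ℚ) * C-column (next j))
    σ-y j = trans (cong₂ (λ p q → (r + r) * ((M - 1ℚ) * ((1ℚ - p) * C-column j + p * C-column (next j))) + ½ * (r * M) * q) t-y ν-y)
      (solve 4 (λ r m p q → (r :+ r) :* ((m :- con 1ℚ) :* ((con 1ℚ :- con 1ℚ) :* p :+ con 1ℚ :* q)) :+ con ½ :* (r :* m) :* con 0ℚ
        := (r :+ r) :* ((m :- con 1ℚ) :* q)) refl r M (C-column j) (C-column (next j)))

    σ-x : ∀ j → σ j x ≡ (r + r) * ((M - 1ℚ) * C-column j)
    σ-x j = trans (cong₂ (λ p q → (r + r) * ((M - 1ℚ) * ((1ℚ - p) * C-column j + p * C-column (next j))) + ½ * (r * M) * q) t-x ν-x)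
      (solve 4 (λ r m p q → (r :+ r) :* ((m :- con 1ℚ) :* ((con 1ℚ :- con 0ℚ) :* p :+ con 0ℚ :* q)) :+ con ½ :* (r :* m) :* con 0ℚ
        := (r :+ r) :* ((m :- con 1ℚ) :* p)) refl r M (C-column j) (C-column (next j)))

    ∑-σ : ∀ j → ∑[ c < m ] σ j c - σ j y ≡
      (r + r) * (M - 1ℚ) * (½ * M) * C-column j + (r + r) * (M - 1ℚ) * (½ * M - 1ℚ) * C-column (next j)
        + ½ * (r * M) * (M - 1ℚ - 1ℚ)
    ∑-σ j = begin
      ∑[ c < m ] σ j c - σ j y
        ≡⟨ cong₂ _-_ (∑-cong {m} (λ c → solve 6 (λ r m t p q z →
               (r :+ r) :* ((m :- con 1ℚ) :* ((con 1ℚ :- t) :* p :+ t :* q)) :+ con ½ :* (r :* m) :* z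
               := (r :+ r) :* ((m :- con 1ℚ) :* p) :+ t :* ((r :+ r) :* ((m :- con 1ℚ) :* (q :- p))) :+ z :* (con ½ :* (r :* m))) refl
               r M (t c) (C-column j) (C-column (next j)) (ν c))) (σ-y j) ⟩
      ∑[ c < m ] (A + t c * B + ν c * E) - (r + r) * ((M - 1ℚ) * C-column (next j))
        ≡⟨ cong (_- (r + r) * ((M - 1ℚ) * C-column (next j)))
             (trans (∑-+ {m} (λ c → A + t c * B) (λ c → ν c * E)) (cong₂ _+_
               (trans (∑-+ {m} (λ _ → A) (λ c → t c * B)) (cong₂ _+_ (∑-const m A) (trans (∑-*ʳ t B) (cong (_* B) ∑-t))))
               (trans (∑-*ʳ ν E) (cong (_* E) ∑-ν)))) ⟩
      (M * A + ½ * M * B + (M - 1ℚ - 1ℚ) * E) - (r + r) * ((M - 1ℚ) * C-column (next j))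
        ≡⟨ solve 4 (λ r m p q →
             (m :* ((r :+ r) :* ((m :- con 1ℚ) :* p)) :+ con ½ :* m :* ((r :+ r) :* ((m :- con 1ℚ) :* (q :- p)))
               :+ (m :- con 1ℚ :- con 1ℚ) :* (con ½ :* (r :* m))) :- (r :+ r) :* ((m :- con 1ℚ) :* q)
             := (r :+ r) :* (m :- con 1ℚ) :* (con ½ :* m) :* p :+ (r :+ r) :* (m :- con 1ℚ) :* (con ½ :* m :- con 1ℚ) :* q
               :+ con ½ :* (r :* m) :* (m :- con 1ℚ :- con 1ℚ)) refl r M (C-column j) (C-column (next j)) ⟩
      (r + r) * (M - 1ℚ) * (½ * M) * C-column j + (r + r) * (M - 1ℚ) * (½ * M - 1ℚ) * C-column (next j)
        + ½ * (r * M) * (M - 1ℚ - 1ℚ) ∎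
      where
      A B E : ℚ
      A = (r + r) * ((M - 1ℚ) * C-column j)
      B = (r + r) * ((M - 1ℚ) * (C-column (next j) - C-column j))
      E = ½ * (r * M)

    total-G : ∑[ u < V ] ∑[ v < V ] G u v ≡
      (r + r) * ((M - 1ℚ) * (M - 1ℚ)) * κ + N * (½ * (r * M) * (M - 1ℚ - 1ℚ))
    total-G = begin
      ∑[ u < V ] ∑[ v < V ] G u v
        ≡⟨ ∑-comm G ⟩
      ∑[ v < V ] ∑[ u < V ] G u v
        ≡⟨ ∑-cong {V} (λ v → trans (∑-vertices {λ i a → g i a (petal v) (place v)} (g-glued (petal v) (place v)))
             (trans (column-G (petal v) (place v))
               (cong (λ z → (r + r) * ((M - 1ℚ) * z) + ½ * (r * M) * ν (place v)) (∑-P (petal v) (place v))))) ⟩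
      ∑[ v < V ] σ (petal v) (place v)
        ≡⟨ ∑-vertices {σ} (λ j → trans (σ-y j) (sym (σ-x (next j)))) ⟩
      ∑[ j < n ] (∑[ c < m ] σ j c - σ j y)
        ≡⟨ ∑-cong {n} ∑-σ ⟩
      ∑[ j < n ] (A * C-column j + B * C-column (next j) + E)
        ≡⟨ trans (∑-+ {n} (λ j → A * C-column j + B * C-column (next j)) (λ _ → E)) (cong₂ _+_
             (trans (∑-+ {n} (λ j → A * C-column j) (λ j → B * C-column (next j))) (cong₂ _+_
               (trans (∑-*ˡ {n} A C-column) (cong (A *_) ∑-column))
               (trans (∑-*ˡ {n} B (λ j → C-column (next j))) (cong (B *_) (trans (∑-next C-column) ∑-column)))))
             (∑-const n E)) ⟩
      A * κ + B * κ + N * E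
        ≡⟨ solve 4 (λ r m k e →
             (r :+ r) :* (m :- con 1ℚ) :* (con ½ :* m) :* k :+ (r :+ r) :* (m :- con 1ℚ) :* (con ½ :* m :- con 1ℚ) :* k :+ e
             := (r :+ r) :* ((m :- con 1ℚ) :* (m :- con 1ℚ)) :* k :+ e) refl r M κ (N * E) ⟩
      (r + r) * ((M - 1ℚ) * (M - 1ℚ)) * κ + N * (½ * (r * M) * (M - 1ℚ - 1ℚ)) ∎
      where
      A B E : ℚ
      A = (r + r) * (M - 1ℚ) * (½ * M)
      B = (r + r) * (M - 1ℚ) * (½ * M - 1ℚ)
      E = ½ * (r * M) * (M - 1ℚ - 1ℚ)

      ∑-column : ∑[ j < n ] C-column j ≡ κ
      ∑-column = sym (∑-comm C)

    ι-V : ι V ≡ N * (M - 1ℚ)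
    ι-V = trans (cong fromℤ (ℤ.pos-* n k)) (trans (fromℤ-* (ℤ.+ n) (ℤ.+ k)) (cong (N *_)
      (trans (solve 1 (λ k → k := (con 1ℚ :+ k) :- con 1ℚ) refl (ι k)) (cong (_- 1ℚ) (sym (ι-suc k))))))

    trace-minus-total : ι V * ∑[ u < V ] G u u - ∑[ u < V ] ∑[ v < V ] G u v ≡
                        kirchhoff-polynomial M N * (⅙ * r)
    trace-minus-total = begin
      ι V * ∑[ u < V ] G u u - ∑[ u < V ] ∑[ v < V ] G u v
        ≡⟨ cong₂ _-_ (cong₂ _*_ ι-V (trans trace-G
               (cong (λ z → (r + r) * z + (M - 1ℚ - 1ℚ) * ((r + r) * (z - ½ * ½ * (N - 1ℚ)) + N * ((1ℚ + ½) * r))) C-trace)))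
             (trans total-G (cong (λ z → (r + r) * ((M - 1ℚ) * (M - 1ℚ)) * z + N * (½ * (r * M) * (M - 1ℚ - 1ℚ))) C-total)) ⟩
      N * (M - 1ℚ) * ((r + r) * T + (M - 1ℚ - 1ℚ) * ((r + r) * (T - ½ * ½ * (N - 1ℚ)) + N * ((1ℚ + ½) * r)))
        - ((r + r) * ((M - 1ℚ) * (M - 1ℚ)) * (½ * ⅙ * (N * (N - 1ℚ) * (N + 1ℚ))) + N * (½ * (r * M) * (M - 1ℚ - 1ℚ)))
        -- Both terms were kept linear in `r`, with `r * M` left unreduced in the total, so this is
        -- a polynomial identity in r, m and n that holds without appeal to rm = 1.
        ≡⟨ solve 3 (λ r m n →
             n :* (m :- con 1ℚ) :* ((r :+ r) :* (con ⅙ :* ((n :- con 1ℚ) :* (n :+ con 1ℚ)))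
               :+ (m :- con 1ℚ :- con 1ℚ) :* ((r :+ r) :* (con ⅙ :* ((n :- con 1ℚ) :* (n :+ con 1ℚ)) :- con ½ :* con ½ :* (n :- con 1ℚ))
                    :+ n :* ((con 1ℚ :+ con ½) :* r)))
             :- ((r :+ r) :* ((m :- con 1ℚ) :* (m :- con 1ℚ)) :* (con ½ :* con ⅙ :* (n :* (n :- con 1ℚ) :* (n :+ con 1ℚ)))
                  :+ n :* (con ½ :* (r :* m) :* (m :- con 1ℚ :- con 1ℚ)))
             := n :* ((con (ι 5) :+ con (ι 12) :* n :+ n :* n) :+ (m :* m) :* (con (- 1ℚ) :+ con (ι 6) :* n :+ n :* n)
                  :- m :* (con 1ℚ :+ con (ι 18) :* n :+ con (ι 2) :* (n :* n))) :* (con ⅙ :* r)) refl r M N ⟩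
      kirchhoff-polynomial M N * (⅙ * r) ∎
      where
      T : ℚ
      T = ⅙ * ((N - 1ℚ) * (N + 1ℚ))

    module _ (w : ℚ) (w*V≡1 : w * ι V ≡ 1ℚ) where
      open Centering (laplacian F) G (λ u → hub u zero) w w*V≡1 (laplacian-sym F) G-sym (laplacian-rows F) LG≡

      flower-kirchhoff : F HasKirchhoffIndex (kirchhoff-polynomial M N * (⅙ * r))
      flower-kirchhoff = (X , X-inverse) , λ L⁺ L⁺-inv → trans (trace-formula L⁺ L⁺-inv) trace-minus-total

  -- The formula as a fraction of integers

  fromℤ-² : ∀ a → fromℤ (a ℤ.^ 2) ≡ fromℤ a * fromℤ a
  fromℤ-² a = trans (fromℤ-* a (a ℤ.* ℤ.+ 1)) (cong (fromℤ a *_) (cong fromℤ (ℤ.*-identityʳ a)))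

  fromℤ-- : ∀ a b → fromℤ (a ℤ.- b) ≡ fromℤ a - fromℤ b
  fromℤ-- a b = trans (fromℤ-+ a (ℤ.- b)) (cong (fromℤ a +_) (fromℤ-neg b))

  kirchhoff-numerator : ℤ → ℤ → ℤ
  kirchhoff-numerator M N =
    N ℤ.* (ℤ.+ 5 ℤ.+ ℤ.+ 12 ℤ.* N ℤ.+ N ℤ.^ 2
           ℤ.+ M ℤ.^ 2 ℤ.* (ℤ.- (ℤ.+ 1) ℤ.+ ℤ.+ 6 ℤ.* N ℤ.+ N ℤ.^ 2)
           ℤ.- M ℤ.* (ℤ.+ 1 ℤ.+ ℤ.+ 18 ℤ.* N ℤ.+ ℤ.+ 2 ℤ.* N ℤ.^ 2))

  fromℤ-kirchhoff-numerator : ∀ M N → fromℤ (kirchhoff-numerator M N) ≡ kirchhoff-polynomial (fromℤ M) (fromℤ N)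
  fromℤ-kirchhoff-numerator M N = trans (fromℤ-* N (a ℤ.+ M ℤ.^ 2 ℤ.* b ℤ.- M ℤ.* (c ℤ.+ d))) (cong (fromℤ N *_)
    (trans (fromℤ-- (a ℤ.+ M ℤ.^ 2 ℤ.* b) (M ℤ.* (c ℤ.+ d))) (cong₂ _-_
      (trans (fromℤ-+ a (M ℤ.^ 2 ℤ.* b)) (cong₂ _+_
        (quadratic (ℤ.+ 5) (ℤ.+ 12))
        (trans (fromℤ-* (M ℤ.^ 2) b) (cong₂ _*_ (fromℤ-² M) (quadratic (ℤ.- (ℤ.+ 1)) (ℤ.+ 6))))))
      (trans (fromℤ-* M (c ℤ.+ d)) (cong (fromℤ M *_)
        (trans (fromℤ-+ c d) (cong₂ _+_
          (linear (ℤ.+ 1) (ℤ.+ 18))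
          (trans (fromℤ-* (ℤ.+ 2) (N ℤ.^ 2)) (cong (ι 2 *_) (fromℤ-² N))))))))))
    where
    a b c d : ℤ
    a = ℤ.+ 5 ℤ.+ ℤ.+ 12 ℤ.* N ℤ.+ N ℤ.^ 2
    b = ℤ.- (ℤ.+ 1) ℤ.+ ℤ.+ 6 ℤ.* N ℤ.+ N ℤ.^ 2
    c = ℤ.+ 1 ℤ.+ ℤ.+ 18 ℤ.* N
    d = ℤ.+ 2 ℤ.* N ℤ.^ 2

    linear : ∀ a b → fromℤ (a ℤ.+ b ℤ.* N) ≡ fromℤ a + fromℤ b * fromℤ N
    linear a b = trans (fromℤ-+ a (b ℤ.* N)) (cong (fromℤ a +_) (fromℤ-* b N))

    quadratic : ∀ a b → fromℤ (a ℤ.+ b ℤ.* N ℤ.+ N ℤ.^ 2) ≡ fromℤ a + fromℤ b * fromℤ N + fromℤ N * fromℤ N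
    quadratic a b = trans (fromℤ-+ (a ℤ.+ b ℤ.* N) (N ℤ.^ 2)) (cong₂ _+_ (linear a b) (fromℤ-² N))

  -- Writing m as `suc (suc k)` and n as `suc n-1` makes m, n and the vertex number n(m - 1) visibly
  -- nonzero, so their reciprocals can be supplied as `r`, `s` and `w`.
  kirchhoff-flower : ∀ {k n-1} (3≤m : 3 ℕ.≤ suc (suc k)) (3≤n : 3 ℕ.≤ suc n-1)
    {x y : Fin (suc (suc k))} (x≢y : x ≢ y) →
    completeFlower 3≤n x≢y HasKirchhoffIndex
      (_/_ (kirchhoff-numerator (ℤ.+ suc (suc k)) (ℤ.+ suc n-1)) (6 ℕ.* suc (suc k)) {{6m≢0 3≤m}})
  kirchhoff-flower {k} {n-1} 3≤m 3≤n x≢y = subst (completeFlower 3≤n x≢y HasKirchhoffIndex_) value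
    (flower-kirchhoff (ℤ.+ 1 / (n ℕ.* suc k)) (/-* (ℤ.+ 1) (n ℕ.* suc k)))
    where
    n m : ℕ
    n = suc n-1
    m = suc (suc k)

    r q : ℚ
    r = ℤ.+ 1 / m
    q = kirchhoff-numerator (ℤ.+ m) (ℤ.+ n) / (6 ℕ.* m)

    open Potential 3≤n x≢y r (/-* (ℤ.+ 1) m) (ℤ.+ 1 / n) (/-* (ℤ.+ 1) n) using (flower-kirchhoff)

    value : kirchhoff-polynomial (ι m) (ι n) * (⅙ * r) ≡ q
    value = begin
      kirchhoff-polynomial (ι m) (ι n) * (⅙ * r)
        ≡⟨ cong (_* (⅙ * r)) (fromℤ-kirchhoff-numerator (ℤ.+ m) (ℤ.+ n)) ⟨
      fromℤ (kirchhoff-numerator (ℤ.+ m) (ℤ.+ n)) * (⅙ * r)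
        ≡⟨ cong (_* (⅙ * r)) (/-* (kirchhoff-numerator (ℤ.+ m) (ℤ.+ n)) (6 ℕ.* m)) ⟨
      q * ι (6 ℕ.* m) * (⅙ * r)
        ≡⟨ cong (λ z → q * z * (⅙ * r)) (trans (cong fromℤ (ℤ.pos-* 6 m)) (fromℤ-* (ℤ.+ 6) (ℤ.+ m))) ⟩
      q * (ι 6 * ι m) * (⅙ * r)
        ≡⟨ solve 3 (λ q m r → q :* (con (ι 6) :* m) :* (con ⅙ :* r) := q :* (r :* m)) refl q (ι m) r ⟩
      q * (r * ι m)
        ≡⟨ cong (q *_) (/-* (ℤ.+ 1) m) ⟩
      q * 1ℚ
        ≡⟨ ℚ.*-identityʳ q ⟩
      q ∎

open import Data.Integer.Base using (+_; -_; _+_; _-_; _*_; _^_)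

theorem4p5 : (m n : ℕ) (3≤m : 3 ℕ.≤ m) (3≤n : 3 ℕ.≤ n) (x y : Fin m) (x≢y : x ≢ y) →
  let M = + m
      N = + n
  in completeFlower 3≤n x≢y HasKirchhoffIndex
     _/_ (N * (+ 5 + + 12 * N + N ^ 2
               + M ^ 2 * (- (+ 1) + + 6 * N + N ^ 2)
               - M * (+ 1 + + 18 * N + + 2 * N ^ 2)))
         (6 ℕ.* m) {{6m≢0 3≤m}}
theorem4p5 (suc zero) (suc _) (s≤s ())
theorem4p5 (suc (suc k)) (suc n-1) 3≤m 3≤n x y x≢y =
  FlowerResistance.kirchhoff-flower 3≤m 3≤n x≢y
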